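{- For all integers $t\ge 6$ and $n\ge 3t-6$, $2n+3t-15\le ar_{\mathcal{P}}(n, M_t)\le 2n+4t-14$.
   Context: All graphs are finite and simple. For $t\ge1$, $M_t$ denotes a matching with $t$ edges (i.e., $t$ pairwise disjoint edges). A subgraph of an edge-colored graph is rainbow if all of its edges have distinct colors. For a planar graph $H$ and an integer $n\ge |H|$, let $\mathcal{T}_n(H)$ be the family of all plane triangulations on $n$ vertices that contain a subgraph isomorphic to $H$. The planar anti-Ramsey number $ar_{\mathcal{P}}(n,H)$ is the maximum number of colors in an edge-coloring of a plane triangulation $T\in\mathcal{T}_n(H)$ such that $T$ contains no rainbow copy of $H$. -}

module Defs where

open import Data.Nat using (ℕ; zero; suc; _+_; _*_)
open import Data.Fin using (Fin)
open import Data.Product using (Σ; ∃; _×_; _,_)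
open import Relation.Binary.PropositionalEquality using (_≡_; _≢_)

iter : ∀ {A : Set} → (A → A) → ℕ → A → A
iter f zero    x = x
iter f (suc k) x = f (iter f k x)

data Reach {n : ℕ} (Adj : Fin n → Fin n → Set) : Fin n → Fin n → Set where
  here : ∀ {u} → Reach Adj u u
  step : ∀ {u v w} → Adj u v → Reach Adj v w → Reach Adj u w

-- A plane triangulation on the vertex set Fin n, given as a combinatorial map
-- (rotation system) of genus 0 whose underlying graph is simple and connected
-- and all of whose faces are triangles.
--   darts     : Fin d, each dart x is an oriented edge from tail x to tail (α x)
--   α         : fixed-point-free involution (reversal of a dart)
--   σ         : permutation rotating darts around their common tail vertex
--   faces     : orbits of φ = σ ∘ α
--   Euler     : V - E + F = 2  (genus 0, i.e. the embedding is in the sphere/plane)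
record PlaneTriangulation (n : ℕ) : Set where
  field
    d     : ℕ
    tail  : Fin d → Fin n
    α     : Fin d → Fin d
    σ     : Fin d → Fin d
    σ⁻¹   : Fin d → Fin d
    α-invol   : ∀ x → α (α x) ≡ x
    α-nofix   : ∀ x → α x ≢ x
    σ-inv₁    : ∀ x → σ (σ⁻¹ x) ≡ x
    σ-inv₂    : ∀ x → σ⁻¹ (σ x) ≡ x
    σ-vertex  : ∀ x → tail (σ x) ≡ tail x
    σ-transitive : ∀ x y → tail x ≡ tail y → ∃ λ k → iter σ k x ≡ y
    no-loop   : ∀ x → tail (α x) ≢ tail x
    no-multi  : ∀ x y → tail x ≡ tail y → tail (α x) ≡ tail (α y) → x ≡ y
    face-tri  : ∀ x → σ (α (σ (α (σ (α x))))) ≡ x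
    face-nontriv : ∀ x → σ (α x) ≢ x
    connected : ∀ u v → Reach (λ a b → ∃ λ x → tail x ≡ a × tail (α x) ≡ b) u v
    euler     : Σ ℕ λ E → Σ ℕ λ F → (2 * E ≡ d) × (3 * F ≡ d) × (n + F ≡ E + 2)

module _ {n : ℕ} (T : PlaneTriangulation n) where
  open PlaneTriangulation T

  head : Fin d → Fin n
  head x = tail (α x)

  record EdgeColoring (k : ℕ) : Set where
    field
      col      : Fin d → Fin k
      col-edge : ∀ x → col (α x) ≡ col x
      col-surj : ∀ c → ∃ λ x → col x ≡ c

  record Matching (t : ℕ) : Set where
    field
      e : Fin t → Fin d
      disjoint : ∀ i j → i ≢ j →
        (tail (e i) ≢ tail (e j)) × (tail (e i) ≢ head (e j)) ×
        (head (e i) ≢ tail (e j)) × (head (e i) ≢ head (e j))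

  ContainsMatching : ℕ → Set
  ContainsMatching t = Matching t

  HasRainbowMatching : ∀ {k} → EdgeColoring k → ℕ → Set
  HasRainbowMatching c t = Σ (Matching t) λ M →
    ∀ i j → i ≢ j → EdgeColoring.col c (Matching.e M i) ≢ EdgeColoring.col c (Matching.e M j)

-- Upper bound.  Keep one edge of each colour and take a matching of this graph G that cannot be improved
-- by adding an edge or by exchanging one edge for two; it has m < t edges.  At most one end of a matching
-- edge has neighbours outside the matching, or else both ends have the same single such neighbour.  With
-- C the covered vertices, I the others, A the ends of the first kind and τ edges of the second kind,
-- e(G) ≤ (3|C| - 6) + (2(|I| + |A|) - 4) + 2τ, where |C| = 2m, |I| = n - 2m and |A| + τ ≤ m.
-- The two planar bounds are derived inside the triangulation: merging the faces on both sides of each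
-- deleted edge, and sparing one edge for each deleted vertex, leaves at least e - v + 2 classes of faces,
-- and the boundary of each class is a closed walk without backtracking, hence has length at least 3
-- (at least 4 in a bipartite graph).
--
-- Lower bound.  Starting from a triangle, repeatedly insert a vertex into a face and join it to the
-- corners.  Take a triangulation on t - 2 hubs with a leaf inside each of its faces, and put all the
-- remaining vertices into one face abc so that they form a path whose vertices, after the first, are
-- adjacent to a and b only.  The edges that meet a hub get distinct colours and the others share one:
-- a rainbow matching uses at most one edge of the path and at most t - 2 edges that meet a hub.

module Submission where

open import Defs
open import Data.Nat using (ℕ; zero; suc; _+_; _*_; _∸_; _≤_; _<_; z≤n; s≤s; s≤s⁻¹; _≤?_)
open import Data.Nat.Properties hiding (_≟_; suc-injective)
open import Data.Nat.Tactic.RingSolver using (solve)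
open import Data.List using ([]; _∷_)
open import Data.Fin using (Fin; zero; suc; toℕ; fromℕ<; punchIn; punchOut)
open import Data.Fin.Patterns using (0F; 1F; 2F)
open import Data.Fin.Properties using (_≟_; any?; suc-injective; toℕ-injective; toℕ<n; toℕ-fromℕ<; fromℕ<-cong; punchOut-cong; punchOut-punchIn; punchInᵢ≢i; +↔⊎; pigeonhole)
open import Data.Fin.Permutation using (permutation)
open import Data.Bool using (if_then_else_)
open import Data.Product using (Σ; ∃; _×_; _,_; proj₁; proj₂; map₂)
open import Data.Sum as Sum using (_⊎_; inj₁; inj₂; [_,_]′)
open import Data.Sum.Function.Propositional using (_⊎-↔_)
open import Data.Unit using (tt)
open import Function using (_∘_; id; _↔_; Inverse)
open import Function.Construct.Composition using (_↔-∘_)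
open import Function.Construct.Identity using (↔-id)
open import Function.Construct.Symmetry using (↔-sym)
open import Relation.Nullary using (¬_; Dec; yes; no; does; contradiction)
open import Relation.Nullary.Decidable using (_×-dec_; _⊎-dec_; ¬?; dec-true; dec-false; decidable-stable; map′)
open import Relation.Unary using (Pred; Decidable)
open import Relation.Binary.PropositionalEquality using (_≡_; _≢_; refl; sym; trans; cong; cong₂; subst)
open import Level using (0ℓ)
open import Algebra.Properties.CommutativeMonoid.Sum +-0-commutativeMonoid using (sum; sum-cong-≗; ∑-distrib-+; ∑-comm; sum-permute)

private
  variable
    a b c l n : ℕ

-- Linear arithmetic: the goal, shifted by s, is a sum of known inequalities up to semiring identities.
cancel-≤ : ∀ s {x y a b} → a ≤ b → x + s ≡ a → b ≡ y + s → x ≤ y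
cancel-≤ s {x} {y} a≤b p q = +-cancelʳ-≤ s x y (≤-trans (≤-reflexive p) (≤-trans a≤b (≤-reflexive q)))

infixr 6 _⊹_
_⊹_ : ∀ {x y u v} → x ≤ y → u ≤ v → x + u ≤ y + v
_⊹_ = +-mono-≤

infixr 7 _⊛_
_⊛_ : ∀ k {x y} → x ≤ y → k * x ≤ k * y
k ⊛ x≤y = *-monoʳ-≤ k x≤y

-- Counting

sum-mono : {f g : Fin n → ℕ} → (∀ i → f i ≤ g i) → sum f ≤ sum g
sum-mono {zero}  f≤g = z≤n
sum-mono {suc n} f≤g = +-mono-≤ (f≤g zero) (sum-mono (f≤g ∘ suc))

sum-const : ∀ n c → sum {n} (λ _ → c) ≡ n * c
sum-const zero    c = refl
sum-const (suc n) c = cong (c +_) (sum-const n c)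

-- The incidences `R` are summed by rows and by columns: the rows dominate `w`, the columns are
-- dominated by `u`.
double-count : (w : Fin a → ℕ) (u : Fin b → ℕ) (R : Fin a → Fin b → ℕ) →
  (∀ i → w i ≤ sum (R i)) → (∀ j → sum (λ i → R i j) ≤ u j) → sum w ≤ sum u
double-count w u R w≤ ≤u =
  ≤-trans (sum-mono w≤) (≤-trans (≤-reflexive (∑-comm R)) (sum-mono ≤u))

ind : {P : Set} → Dec P → ℕ
ind P? = if does P? then 1 else 0

ind-yes : {P : Set} (P? : Dec P) → P → ind P? ≡ 1
ind-yes P? p = cong (if_then 1 else 0) (dec-true P? p)

ind-no : {P : Set} (P? : Dec P) → ¬ P → ind P? ≡ 0
ind-no P? ¬p = cong (if_then 1 else 0) (dec-false P? ¬p)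

ind≤1 : {P : Set} (P? : Dec P) → ind P? ≤ 1
ind≤1 (yes _) = ≤-refl
ind≤1 (no _)  = z≤n

ind-≤ : {P : Set} (P? : Dec P) {m : ℕ} → (P → 1 ≤ m) → ind P? ≤ m
ind-≤ (yes p) 1≤m = 1≤m p
ind-≤ (no _)  1≤m = z≤n

-- The function `f` allows bounds in which the indicator occurs several times, such as
-- `ind P? + ind P?`.
≤-ind : {P : Set} (P? : Dec P) (f : ℕ → ℕ) {m : ℕ} → (P → m ≤ f 1) → (¬ P → m ≤ f 0) → m ≤ f (ind P?)
≤-ind (yes p) f y n = y p
≤-ind (no ¬p) f y n = n ¬p

ind-⊎ : {P Q R : Set} (P? : Dec P) (Q? : Dec Q) (R? : Dec R) → (P → Q ⊎ R) → ind P? ≤ ind Q? + ind R?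
ind-⊎ P? Q? R? split = ind-≤ P? λ p → [ (λ q → ≤-trans (≤-reflexive (sym (ind-yes Q? q))) (m≤m+n _ _))
                                      , (λ r → ≤-trans (≤-reflexive (sym (ind-yes R? r))) (m≤n+m _ _)) ]′ (split p)

ind-disjoint : {P Q R : Set} (P? : Dec P) (Q? : Dec Q) (R? : Dec R) →
  (Q → P) → (R → P) → (Q → ¬ R) → ind Q? + ind R? ≤ ind P?
ind-disjoint P? (yes q) R? Q⊆P R⊆P dis =
  ≤-reflexive (trans (cong suc (ind-no R? (dis q))) (sym (ind-yes P? (Q⊆P q))))
ind-disjoint P? (no _) R? Q⊆P R⊆P dis = ind-≤ R? λ r → ≤-reflexive (sym (ind-yes P? (R⊆P r)))

count : {P : Pred (Fin n) 0ℓ} → Decidable P → ℕ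
count P? = sum (λ x → ind (P? x))

sum-+ : (f g : Fin n → ℕ) → sum (λ x → f x + g x) ≡ sum f + sum g
sum-+ = ∑-distrib-+

module _ {P : Pred (Fin n) 0ℓ} (P? : Decidable P) where

  count-none : (∀ x → ¬ P x) → count P? ≡ 0
  count-none ¬P = trans (sum-cong-≗ (λ x → ind-no (P? x) (¬P x))) (trans (sum-const n 0) (*-zeroʳ n))

  count-all : (∀ x → P x) → count P? ≡ n
  count-all all = trans (sum-cong-≗ (λ x → ind-yes (P? x) (all x))) (trans (sum-const n 1) (*-identityʳ n))

  count≤n : count P? ≤ n
  count≤n = ≤-trans (sum-mono (λ x → ind≤1 (P? x))) (≤-reflexive (trans (sum-const n 1) (*-identityʳ n)))

  count-witness : 1 ≤ count P? → ∃ P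
  count-witness 1≤ with any? P?
  ... | yes w = w
  ... | no ¬w = contradiction (subst (1 ≤_) (count-none (λ x p → ¬w (x , p))) 1≤) λ ()

  count-∁ : count P? + count (¬? ∘ P?) ≡ n
  count-∁ = trans (sym (sum-+ {n} (λ x → ind (P? x)) _)) (trans (sum-cong-≗ {n} pointwise) (trans (sum-const n 1) (*-identityʳ n)))
    where
    pointwise : ∀ x → ind (P? x) + ind (¬? (P? x)) ≡ 1
    pointwise x with P? x
    ... | yes _ = refl
    ... | no  _ = refl

  count-permute : (f g : Fin n → Fin n) → (∀ x → f (g x) ≡ x) → (∀ x → g (f x) ≡ x) → count (P? ∘ f) ≡ count P?
  count-permute f g f∘g g∘f = sym (sum-permute (λ x → ind (P? x)) (permutation f g f∘g g∘f))

module _ {P Q : Pred (Fin n) 0ℓ} (P? : Decidable P) (Q? : Decidable Q) where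

  count-mono : (∀ x → P x → Q x) → count P? ≤ count Q?
  count-mono P⊆Q = sum-mono λ x → ind-≤ (P? x) λ p → ≤-reflexive (sym (ind-yes (Q? x) (P⊆Q x p)))

module _ {P Q R : Pred (Fin n) 0ℓ} (P? : Decidable P) (Q? : Decidable Q) (R? : Decidable R) where

  count-⊎ : (∀ x → P x → Q x ⊎ R x) → count P? ≤ count Q? + count R?
  count-⊎ split = ≤-trans (sum-mono (λ x → ind-⊎ (P? x) (Q? x) (R? x) (split x))) (≤-reflexive (sum-+ (λ x → ind (Q? x)) (λ x → ind (R? x))))

  count-disjoint : (∀ x → Q x → P x) → (∀ x → R x → P x) → (∀ x → Q x → ¬ R x) → count Q? + count R? ≤ count P?
  count-disjoint Q⊆P R⊆P dis = ≤-trans (≤-reflexive (sym (sum-+ (λ x → ind (Q? x)) (λ x → ind (R? x)))))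
    (sum-mono (λ x → ind-disjoint (P? x) (Q? x) (R? x) (Q⊆P x) (R⊆P x) (dis x)))

count-singleton : (x : Fin n) → count (_≟ x) ≡ 1
count-singleton {suc n} zero    = cong suc (count-none {n} (λ i → suc i ≟ zero) λ _ ())
count-singleton {suc n} (suc x) = count-singleton x

module _ {P : Pred (Fin n) 0ℓ} (P? : Decidable P) where

  count-remove : ∀ {x} → P x → suc (count (λ y → P? y ×-dec ¬? (y ≟ x))) ≤ count P?
  count-remove {x} p = ≤-trans (≤-reflexive (cong (_+ count (λ y → P? y ×-dec ¬? (y ≟ x))) (sym (count-singleton x))))
    (count-disjoint P? (_≟ x) (λ y → P? y ×-dec ¬? (y ≟ x)) (λ { _ refl → p }) (λ _ → proj₁) (λ { _ refl (_ , y≢y) → y≢y refl }))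

  count-unique : (∀ {x y} → P x → P y → x ≡ y) → count P? ≤ 1
  count-unique unique with any? P?
  ... | yes (x , p) = ≤-trans (count-mono P? (_≟ x) (λ y q → unique q p)) (≤-reflexive (count-singleton x))
  ... | no ¬w = ≤-trans (≤-reflexive (count-none P? (λ x p → ¬w (x , p)))) z≤n

  count≥1 : ∀ {x} → P x → 1 ≤ count P?
  count≥1 p = ≤-trans (s≤s z≤n) (count-remove p)

module _ {P : Pred (Fin n) 0ℓ} (P? : Decidable P) where

  count≥2 : ∀ {x y} → P x → P y → y ≢ x → 2 ≤ count P?
  count≥2 {x} p q y≢x = ≤-trans (s≤s (count≥1 (λ y → P? y ×-dec ¬? (y ≟ x)) (q , y≢x))) (count-remove P? p)

  -- The fibres of `f` are disjoint. Applied to the labels of darts it turns a minimum length of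
  -- faces into an edge count, and applied to colours it counts two darts per colour.
  fibre-bound : ∀ m (f : Fin n → Fin c) → (∀ j → m ≤ count (λ x → P? x ×-dec f x ≟ j)) → c * m ≤ count P?
  fibre-bound {c} m f m≤ = subst (_≤ count P?) (sum-const c m)
    (double-count (λ _ → m) _ (λ j x → ind (P? x ×-dec f x ≟ j)) m≤ bound)
    where
    bound : ∀ x → sum (λ j → ind (P? x ×-dec f x ≟ j)) ≤ ind (P? x)
    bound x with P? x
    ... | yes p = count-unique (λ j → yes p ×-dec f x ≟ j) (λ (_ , e) (_ , e′) → trans (sym e) e′)
    ... | no ¬p = ≤-reflexive (trans (sum-const c 0) (*-zeroʳ c))

module _ {P : Pred (Fin n) 0ℓ} (P? : Decidable P) where

  count≥3 : ∀ {x y z} → P x → P y → P z → y ≢ x → z ≢ x → z ≢ y → 3 ≤ count P?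
  count≥3 {x} p q r y≢x z≢x z≢y =
    ≤-trans (s≤s (count≥2 (λ y → P? y ×-dec ¬? (y ≟ x)) (q , y≢x) (r , z≢x) z≢y)) (count-remove P? p)

module _ {P : Pred (Fin n) 0ℓ} (P? : Decidable P) where

  count≥4 : ∀ {w x y z} → P w → P x → P y → P z →
    x ≢ w → y ≢ w → z ≢ w → y ≢ x → z ≢ x → z ≢ y → 4 ≤ count P?
  count≥4 {w} o p q r x≢w y≢w z≢w y≢x z≢x z≢y =
    ≤-trans (s≤s (count≥3 (λ y → P? y ×-dec ¬? (y ≟ w)) (p , x≢w) (q , y≢w) (r , z≢w) y≢x z≢x z≢y)) (count-remove P? o)

-- Labellings and merging

-- A partition of the darts, given by a surjection so that its number of classes is available as a
-- number. The classes stand for the faces that arise when edges are deleted.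
record Labelling (d : ℕ) : Set where
  field
    classes : ℕ
    label   : Fin d → Fin classes
    onto    : ∀ j → ∃ λ x → label x ≡ j

open Labelling

Coarser : Labelling l → Labelling l → Set
Coarser L L′ = ∀ {x y} → label L x ≡ label L y → label L′ x ≡ label L′ y

discrete : Labelling l
discrete {l} = record { classes = l ; label = id ; onto = λ j → j , refl }

-- The label of `x` is sent to that of `y` and then removed from the range by `punchOut`, so at most
-- one class is lost.
merge : (L : Labelling l) (x y : Fin l) →
  ∃ λ L′ → Coarser L L′ × label L′ x ≡ label L′ y × classes L ≤ suc (classes L′)
merge L x y with label L x ≟ label L y
... | yes e = L , id , e , n≤1+n _
merge record { classes = zero ; label = ℓ } x y | no _ = contradiction (ℓ x) λ ()
merge record { classes = suc c ; label = ℓ ; onto = onto } x y | no ℓx≢ℓy =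
  record { classes = c ; label = f ∘ ℓ ; onto = f-onto } , cong f , f-merges , ≤-refl
  where
  f : Fin (suc c) → Fin c
  f j with ℓ x ≟ j
  ... | yes _   = punchOut ℓx≢ℓy
  ... | no ℓx≢j = punchOut ℓx≢j

  f-merges : f (ℓ x) ≡ f (ℓ y)
  f-merges with ℓ x ≟ ℓ x | ℓ x ≟ ℓ y
  ... | no ≢ | _     = contradiction refl ≢
  ... | yes _ | yes e = contradiction e ℓx≢ℓy
  ... | yes _ | no _  = punchOut-cong (ℓ x) refl

  f-punchIn : ∀ j → f (punchIn (ℓ x) j) ≡ j
  f-punchIn j with ℓ x ≟ punchIn (ℓ x) j
  ... | yes e = contradiction (sym e) (punchInᵢ≢i (ℓ x) j)
  ... | no ≢  = trans (punchOut-cong (ℓ x) refl) (punchOut-punchIn (ℓ x))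

  f-onto : ∀ j → ∃ λ w → f (ℓ w) ≡ j
  f-onto j with w , e ← onto (punchIn (ℓ x) j) = w , trans (cong f e) (f-punchIn j)

-- The pairs are merged one after another. Coarsening preserves the earlier identifications, and
-- each pair costs at most one class.
merge-all : {P : Pred (Fin c) 0ℓ} (P? : Decidable P) (f g : Fin c → Fin l) (L : Labelling l) →
  ∃ λ L′ → Coarser L L′ × (∀ i → P i → label L′ (f i) ≡ label L′ (g i)) × classes L ≤ count P? + classes L′
merge-all {zero}  P? f g L = L , id , (λ ()) , ≤-refl
merge-all {suc c} P? f g L with P? zero
... | no ¬p with L′ , coarser , merged , bound ← merge-all (P? ∘ suc) (f ∘ suc) (g ∘ suc) L =
  L′ , coarser , (λ { zero p → contradiction p ¬p ; (suc i) → merged i }) , bound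
... | yes _ with L₁ , coarser₁ , e , bound₁ ← merge L (f zero) (g zero)
            with L′ , coarser , merged , bound ← merge-all (P? ∘ suc) (f ∘ suc) (g ∘ suc) L₁ =
  L′ , coarser ∘ coarser₁ , (λ { zero _ → coarser e ; (suc i) → merged i }) , ≤-trans bound₁ (s≤s bound)

-- Euler's inequality for subgraphs of a triangulation

-- Deletion of one vertex with `p` edges to the remaining ones: `2 * p` darts disappear at the price
-- of only `m < p` merges, and the merge saved pays for the new outside vertex. Primed quantities
-- belong to the situation before the deletion.
deletion-arithmetic : ∀ F d {o i o′ i′ p c′ m c} →
  2 * F + 2 * o′ + i′ ≤ 2 * c′ + d → i + (p + p) ≤ i′ → o ≤ o′ + 1 → c′ ≤ m + c → suc m ≤ p →
  2 * F + 2 * o + i ≤ 2 * c + d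
deletion-arithmetic F d {o} {i} {o′} {i′} {p} {c′} {m} {c} h₁ h₂ h₃ h₄ h₅ =
  cancel-≤ (2 * o′ + i′ + 2 * p + 2 * c′ + 2 * suc m)
    (h₁ ⊹ h₂ ⊹ 2 ⊛ h₃ ⊹ 2 ⊛ h₄ ⊹ 2 ⊛ h₅)
    (solve (F ∷ d ∷ o ∷ i ∷ o′ ∷ i′ ∷ p ∷ c′ ∷ m ∷ c ∷ []))
    (solve (F ∷ d ∷ o ∷ i ∷ o′ ∷ i′ ∷ p ∷ c′ ∷ m ∷ c ∷ []))

-- Euler's formula for `T` eliminates `n`, `E` and `F`. What remains is e - q + 2 ≤ c for a graph
-- with q vertices and e edges, where `g` = 2e counts darts.
restriction-arithmetic : ∀ {F o i c′ m c g b q n d E} →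
  2 * F + 2 * o + i ≤ 2 * c′ + d → g + b ≤ i → c′ ≤ m + c → m + m ≤ b →
  q + o ≡ n → 2 * E ≡ d → n + F ≡ E + 2 → g + 4 ≤ 2 * c + 2 * q
restriction-arithmetic {F} {o} {i} {c′} {m} {c} {g} {b} {q} {E = E} h₁ h₂ h₃ h₄ refl refl h₇ =
  cancel-≤ (2 * F + 2 * o + i + b + 2 * c′ + 2 * m + 2 * E)
    (h₁ ⊹ h₂ ⊹ 2 ⊛ h₃ ⊹ h₄ ⊹ 2 ⊛ ≤-reflexive (sym h₇))
    (solve (F ∷ o ∷ i ∷ c′ ∷ m ∷ c ∷ g ∷ b ∷ q ∷ E ∷ []))
    (solve (F ∷ o ∷ i ∷ c′ ∷ m ∷ c ∷ g ∷ b ∷ q ∷ E ∷ []))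

-- In terms of edges, e ≤ 3q - 6; `faces-4` is likewise e ≤ 2q - 4.
faces-3 : ∀ {g} c q → g + 4 ≤ 2 * c + 2 * q → c * 3 ≤ g → g + 12 ≤ 6 * q
faces-3 {g} c q h₁ h₂ = cancel-≤ (2 * g + 2 * (c * 3)) (3 ⊛ h₁ ⊹ 2 ⊛ h₂)
  (solve (g ∷ c ∷ q ∷ [])) (solve (g ∷ c ∷ q ∷ []))

faces-4 : ∀ {g} c q → g + 4 ≤ 2 * c + 2 * q → c * 4 ≤ g → g + 8 ≤ 4 * q
faces-4 {g} c q h₁ h₂ = cancel-≤ (g + c * 4) (2 ⊛ h₁ ⊹ h₂)
  (solve (g ∷ c ∷ q ∷ [])) (solve (g ∷ c ∷ q ∷ []))

module Planar {n : ℕ} (T : PlaneTriangulation n) where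
  open PlaneTriangulation T

  hd : Fin d → Fin n
  hd = head T

  φ : Fin d → Fin d
  φ x = σ (α x)

  Adjacent : Fin n → Fin n → Set
  Adjacent u v = ∃ λ x → tail x ≡ u × hd x ≡ v

  hd-α : ∀ x → hd (α x) ≡ tail x
  hd-α x = cong tail (α-invol x)

  tail-φ : ∀ x → tail (φ x) ≡ hd x
  tail-φ x = σ-vertex (α x)

  φ-α : ∀ x → φ (α x) ≡ σ x
  φ-α x = cong σ (α-invol x)

  -- Every class is then a union of faces of `T`.
  FaceLabelling : Labelling d → Set
  FaceLabelling L = ∀ x → label L (φ x) ≡ label L x

  -- The faces on the two sides of the edge lie in one class, as they do once the edge is deleted.
  Respects : Labelling d → Fin d → Set
  Respects L x = label L x ≡ label L (α x)

  -- `σ x` comes right after `α x` on the boundary of a face.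
  label-σ : ∀ L → FaceLabelling L → ∀ x → label L (σ x) ≡ label L (α x)
  label-σ L face x = trans (cong (label L) (sym (φ-α x))) (face (α x))

  -- `σ` leads from `x` to `y` around their common tail, and the property must be lost at some step
  -- on the way.
  rotate : {P : Fin d → Set} → Decidable P → ∀ {x y} → tail x ≡ tail y → P x → ¬ P y →
    ∃ λ z → tail z ≡ tail x × P z × ¬ P (σ z)
  rotate {P} P? {x} {y} e p ¬p with k , refl ← σ-transitive x y e = go k ¬p
    where
    tail-iter : ∀ k → tail (iter σ k x) ≡ tail x
    tail-iter zero    = refl
    tail-iter (suc k) = trans (σ-vertex _) (tail-iter k)

    go : ∀ k → ¬ P (iter σ k x) → ∃ λ z → tail z ≡ tail x × P z × ¬ P (σ z)
    go zero ¬p = contradiction p ¬p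
    go (suc k) ¬p with P? (iter σ k x)
    ... | yes q = iter σ k x , tail-iter k , q , ¬p
    ... | no ¬q = go k ¬q

  -- Merging every dart but the least of its face with its φ-successor costs two merges per face.
  Least : Fin d → Set
  Least x = toℕ x ≤ toℕ (φ x) × toℕ x ≤ toℕ (φ (φ x))

  Least? : Decidable Least
  Least? x = (toℕ x ≤? toℕ (φ x)) ×-dec (toℕ x ≤? toℕ (φ (φ x)))

  least-in-face : ∀ x → Least x ⊎ Least (φ x) ⊎ Least (φ (φ x))
  least-in-face x with ≤-total (toℕ x) (toℕ (φ x)) | ≤-total (toℕ (φ x)) (toℕ (φ (φ x))) | ≤-total (toℕ (φ (φ x))) (toℕ x)
  ... | inj₁ x≤y | inj₁ y≤z | _ = inj₁ (x≤y , ≤-trans x≤y y≤z)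
  ... | inj₁ x≤y | inj₂ z≤y | inj₂ x≤z = inj₁ (x≤y , x≤z)
  ... | _ | inj₂ z≤y | inj₁ z≤x =
    inj₂ (inj₂ (subst (λ w → toℕ (φ (φ x)) ≤ toℕ w) (sym (face-tri x)) z≤x
               , subst (λ w → toℕ (φ (φ x)) ≤ toℕ (φ w)) (sym (face-tri x)) z≤y))
  ... | inj₂ y≤x | inj₁ y≤z | _ =
    inj₂ (inj₁ (y≤z , subst (λ w → toℕ (φ x) ≤ toℕ w) (sym (face-tri x)) y≤x))
  ... | inj₂ y≤x | inj₂ z≤y | inj₂ x≤z = inj₁ (≤-trans x≤z z≤y , x≤z)

  -- Every face contains a least dart, so `Least` and its two shifts along `φ`, all of the same
  -- size, cover the `3 * F` darts.
  faces≤count-Least : ∀ F → 3 * F ≡ d → F ≤ count Least?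
  faces≤count-Least F 3F≡d = *-cancelˡ-≤ 3 (begin
    3 * F                                             ≡⟨ 3F≡d ⟩
    d                                                 ≡⟨ count-all {d} (λ _ → yes tt) (λ _ → tt) ⟨
    count {d} (λ _ → yes tt)                          ≤⟨ count-⊎ (λ _ → yes tt) Least? (λ x → Least? (φ x) ⊎-dec Least? (φ (φ x))) (λ x _ → least-in-face x) ⟩
    cL + count (λ x → Least? (φ x) ⊎-dec Least? (φ (φ x)))
      ≤⟨ +-monoʳ-≤ cL (count-⊎ (λ x → Least? (φ x) ⊎-dec Least? (φ (φ x))) (Least? ∘ φ) (Least? ∘ φ ∘ φ) (λ _ → id)) ⟩
    cL + (count (Least? ∘ φ) + count (Least? ∘ φ ∘ φ))
      ≡⟨ cong (cL +_) (cong₂ _+_ (count-permute Least? φ (φ ∘ φ) face-tri face-tri) (count-permute Least? (φ ∘ φ) φ face-tri face-tri)) ⟩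
    cL + (cL + cL)                                    ≡⟨ cong (λ m → cL + (cL + m)) (sym (+-identityʳ cL)) ⟩
    3 * cL                                            ∎)
    where
    open ≤-Reasoning
    cL = count Least?

  face-labelling : ∀ F → 3 * F ≡ d → ∃ λ L → FaceLabelling L × F ≤ classes L
  face-labelling F 3F≡d with L , _ , merged , bound ← merge-all (¬? ∘ Least?) id φ discrete =
    L , face L merged , ≤-trans (faces≤count-Least F 3F≡d)
      (+-cancelˡ-≤ (count (¬? ∘ Least?)) _ _ (≤-trans (≤-reflexive (trans (+-comm (count (¬? ∘ Least?)) _) (count-∁ Least?))) bound))
    where
    face : ∀ L → (∀ x → ¬ Least x → label L x ≡ label L (φ x)) → FaceLabelling L
    face L merged x with Least? x
    ... | no ¬p = sym (merged x ¬p)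
    -- The two other darts of the face are not least, since equal indices would contradict
    -- `face-nontriv`; their merges lead from `φ x` around the face to `x`.
    ... | yes (x≤φx , x≤φφx) = sym (trans (cong (label L) (sym (face-tri x)))
      (sym (trans (merged (φ x) ¬least₁) (merged (φ (φ x)) ¬least₂))))
      where
      ¬least₁ : ¬ Least (φ x)
      ¬least₁ (_ , φx≤) = face-nontriv x (toℕ-injective (≤-antisym (subst (λ y → toℕ (φ x) ≤ toℕ y) (face-tri x) φx≤) x≤φx))

      ¬least₂ : ¬ Least (φ (φ x))
      ¬least₂ (φφx≤ , _) = face-nontriv (φ (φ x)) (trans (face-tri x)
        (sym (toℕ-injective (≤-antisym (subst (λ y → toℕ (φ (φ x)) ≤ toℕ y) (face-tri x) φφx≤) x≤φφx))))

  sym-permute : {P : Fin d → Set} (P? : Decidable P) → count (P? ∘ α) ≡ count P?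
  sym-permute P? = count-permute P? α α α-invol α-invol

  Within : (Fin n → Set) → Fin d → Set
  Within Q x = Q (tail x) × Q (hd x)

  within? : {Q : Fin n → Set} → Decidable Q → Decidable (Within Q)
  within? Q? x = Q? (tail x) ×-dec Q? (hd x)

  -- The first edge leaving `Q` on a path from inside to outside, reversed.
  crossing-dart : {Q : Fin n → Set} → Decidable Q → ∃ Q → (∃ λ v → ¬ Q v) → ∃ λ x → ¬ Q (tail x) × Q (hd x)
  crossing-dart {Q} Q? (u , q) (v , ¬q) = go q (connected u v)
    where
    go : ∀ {u} → Q u → Reach Adjacent u v → ∃ λ x → ¬ Q (tail x) × Q (hd x)
    go q here = contradiction q ¬q
    go q (step {v = w} (x , refl , refl) r) with Q? w
    ... | yes q′ = go q′ r
    ... | no ¬q′ = α x , ¬q′ , subst Q (sym (hd-α x)) q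

  module _ (F : ℕ) (3F≡d : 3 * F ≡ d) where

    -- Deleting the vertices outside Q one at a time.  When u is deleted, all but one of the edges
    -- joining u to the remaining vertices need a merge: rotating around u takes care of the last one.
    merge-outside : ∀ fuel {Q : Fin n → Set} (Q? : Decidable Q) → ∃ Q → count (¬? ∘ Q?) ≤ fuel →
      ∃ λ L → FaceLabelling L × (∀ x → ¬ Within Q x → Respects L x) ×
              2 * F + 2 * count (¬? ∘ Q?) + count (within? Q?) ≤ 2 * classes L + d
    merge-outside fuel {Q} Q? q ≤fuel with any? (¬? ∘ Q?)
    merge-outside fuel {Q} Q? q ≤fuel | no all with L , face , F≤ ← face-labelling F 3F≡d =
      L , face , (λ x ¬in → contradiction (Q-all (tail x) , Q-all (hd x)) ¬in) ,
      subst (λ m → 2 * F + 2 * m + count (within? Q?) ≤ 2 * classes L + d) (sym (count-none (¬? ∘ Q?) (λ v ¬q → all (v , ¬q))))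
        (+-mono-≤ (≤-trans (≤-reflexive (+-identityʳ (2 * F))) (*-monoʳ-≤ 2 F≤)) (count≤n (within? Q?)))
      where
      Q-all : ∀ v → Q v
      Q-all v = decidable-stable (Q? v) (λ ¬q → all (v , ¬q))
    merge-outside zero {Q} Q? q ≤fuel | yes (v , ¬q) =
      contradiction (≤-trans (count≥1 (¬? ∘ Q?) ¬q) ≤fuel) λ ()
    merge-outside (suc fuel) {Q} Q? q ≤fuel | yes v
      -- The vertex `tail x₀` has a neighbour in `Q`, hence an edge to spare. The recursive call
      -- deletes all other outside vertices first, so this one is deleted last.
      with x₀ , ¬q₀ , q₀ ← crossing-dart Q? q v
      with L′ , face′ , respects′ , bound′ ← merge-outside fuel (λ v → Q? v ⊎-dec v ≟ tail x₀) (map₂ inj₁ q)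
             (s≤s⁻¹ (≤-trans (≤-trans (s≤s (count-mono (¬? ∘ λ v → Q? v ⊎-dec v ≟ tail x₀) (λ v → ¬? (Q? v) ×-dec ¬? (v ≟ tail x₀))
                (λ v ¬q′ → ¬q′ ∘ inj₁ , ¬q′ ∘ inj₂))) (count-remove (¬? ∘ Q?) ¬q₀)) ≤fuel))
      with L , coarser , merged , bound ← merge-all (λ x → (tail x ≟ tail x₀ ×-dec Q? (hd x)) ×-dec ¬? (x ≟ x₀)) id α L′ =
      L , face , respects , arithmetic
      where
      u = tail x₀

      Q′ : Fin n → Set
      Q′ v = Q v ⊎ v ≡ u

      Q′? : Decidable Q′
      Q′? v = Q? v ⊎-dec v ≟ u

      face : FaceLabelling L
      face x = coarser (face′ x)

      away : ∀ {x} → tail x ≡ u → x ≢ x₀ → Respects L x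
      away {x} e x≢x₀ with Q? (hd x)
      ... | yes qh = merged x ((e , qh) , x≢x₀)
      ... | no ¬qh = coarser (respects′ x λ (_ , q′) → [ ¬qh , (λ e′ → no-loop x (trans e′ (sym e))) ]′ q′)

      at-x₀ : Respects L x₀
      at-x₀ with label L x₀ ≟ label L (α x₀)
      ... | yes e = e
      -- Turning from `σ x₀`, which is labelled like `α x₀`, back to `x₀`, the label would change at
      -- some dart `z` other than `x₀`; but all such edges have equal labels on both sides.
      ... | no ≢ with z , tz , e , ¬e ← rotate (λ z → label L z ≟ label L (α x₀)) (σ-vertex x₀) (label-σ L face x₀) ≢ =
        contradiction (trans (label-σ L face z) (trans (sym (away (trans tz (σ-vertex x₀)) (λ { refl → ≢ e }))) e)) ¬e

      from-u : ∀ {x} → tail x ≡ u → Respects L x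
      from-u {x} e with x ≟ x₀
      ... | yes refl = at-x₀
      ... | no x≢x₀  = away e x≢x₀

      respects : ∀ x → ¬ Within Q x → Respects L x
      respects x ¬in with tail x ≟ u | hd x ≟ u
      ... | yes e | _     = from-u e
      ... | no _  | yes e = trans (cong (label L) (sym (α-invol x))) (sym (from-u e))
      ... | no t≢ | no h≢ = coarser (respects′ x λ (qt , qh) →
        ¬in ([ id , (λ e → contradiction e t≢) ]′ qt , [ id , (λ e → contradiction e h≢) ]′ qh))

      Spoke? : Decidable (λ x → tail x ≡ u × Q (hd x))
      Spoke? x = tail x ≟ u ×-dec Q? (hd x)

      spokes : ℕ
      spokes = count Spoke?

      outside : count (¬? ∘ Q?) ≤ count (¬? ∘ Q′?) + 1
      outside = subst (λ m → count (¬? ∘ Q?) ≤ count (¬? ∘ Q′?) + m) (count-singleton u)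
        (count-⊎ (¬? ∘ Q?) (¬? ∘ Q′?) (_≟ u) split)
        where
        split : ∀ v → ¬ Q v → ¬ Q′ v ⊎ v ≡ u
        split v ¬q with v ≟ u
        ... | yes e = inj₂ e
        ... | no ≢  = inj₁ [ ¬q , ≢ ]′

      inside : count (within? Q?) + (spokes + spokes) ≤ count (within? Q′?)
      inside = subst (λ m → count (within? Q?) + (spokes + m) ≤ count (within? Q′?)) (sym-permute Spoke?)
        (≤-trans (+-monoʳ-≤ (count (within? Q?)) (count-disjoint (λ x → Spoke? x ⊎-dec Spoke? (α x)) Spoke? (Spoke? ∘ α) (λ _ → inj₁) (λ _ → inj₂)
                    λ x (e , _) (_ , qt) → ¬q₀ (subst Q (trans (hd-α x) e) qt)))
          (count-disjoint (within? Q′?) (within? Q?) (λ x → Spoke? x ⊎-dec Spoke? (α x))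
            (λ _ (qt , qh) → inj₁ qt , inj₁ qh)
            (λ x → [ (λ (e , qh) → inj₂ e , inj₁ qh) , (λ (e , qt) → inj₁ (subst Q (hd-α x) qt) , inj₂ e) ]′)
            (λ x (qt , qh) → [ (λ (e , _) → ¬q₀ (subst Q e qt)) , (λ (e , _) → ¬q₀ (subst Q e qh)) ]′)))

      arithmetic : 2 * F + 2 * count (¬? ∘ Q?) + count (within? Q?) ≤ 2 * classes L + d
      arithmetic = deletion-arithmetic F d bound′ inside outside bound (count-remove Spoke? (refl , q₀))

  module _ {Q : Fin n → Set} (Q? : Decidable Q) {G : Fin d → Set} (G? : Decidable G)
           (G-sym : ∀ {x} → G x → G (α x)) (G⊆Q : ∀ {x} → G x → Within Q x) where

    -- Euler's inequality for the subgraph of T with vertex set Q and edge set G; the classes of L play the role of its faces.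
    merge-non-edges : ∃ Q → ∃ λ L → FaceLabelling L × (∀ x → ¬ G x → Respects L x) × count G? + 4 ≤ 2 * classes L + 2 * count Q?
    merge-non-edges q with E , F , 2E≡d , 3F≡d , n+F≡E+2 ← euler
      with L′ , face′ , respects′ , bound′ ← merge-outside F 3F≡d n Q? q (count≤n (¬? ∘ Q?))
      -- Comparing `x` with `α x` selects one dart of each deleted edge, so that the edge is paid
      -- for by a single merge.
      with L , coarser , merged , bound ← merge-all (λ x → (within? Q? x ×-dec ¬? (G? x)) ×-dec (toℕ x ≤? toℕ (α x))) id α L′ =
      L , (λ x → coarser (face′ x)) , respects ,
      restriction-arithmetic {F} {count (¬? ∘ Q?)} {m = count Chosen?} {c = classes L} {b = count Deleted?} {q = count Q?} bound′ inside bound half (count-∁ Q?) 2E≡d n+F≡E+2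
      where
      Deleted? : Decidable (λ x → Within Q x × ¬ G x)
      Deleted? x = within? Q? x ×-dec ¬? (G? x)

      Chosen? : Decidable (λ x → (Within Q x × ¬ G x) × toℕ x ≤ toℕ (α x))
      Chosen? x = Deleted? x ×-dec (toℕ x ≤? toℕ (α x))

      G-sym′ : ∀ {x} → G (α x) → G x
      G-sym′ {x} g = subst G (α-invol x) (G-sym g)

      Deleted-sym : ∀ {x} → Within Q x × ¬ G x → Within Q (α x) × ¬ G (α x)
      Deleted-sym {x} ((qt , qh) , ¬g) = (qh , subst Q (sym (hd-α x)) qt) , ¬g ∘ G-sym′

      respects : ∀ x → ¬ G x → Respects L x
      respects x ¬g with within? Q? x | ≤-total (toℕ x) (toℕ (α x))
      ... | no ¬in | _ = coarser (respects′ x ¬in)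
      ... | yes w | inj₁ x≤αx = merged x ((w , ¬g) , x≤αx)
      ... | yes w | inj₂ αx≤x = trans (cong (label L) (sym (α-invol x)))
        (sym (merged (α x) (Deleted-sym (w , ¬g) , subst (λ y → toℕ (α x) ≤ toℕ y) (sym (α-invol x)) αx≤x)))

      inside : count G? + count Deleted? ≤ count (within? Q?)
      inside = count-disjoint (within? Q?) G? Deleted? (λ _ → G⊆Q) (λ _ → proj₁) (λ _ g (_ , ¬g) → ¬g g)

      half : count Chosen? + count Chosen? ≤ count Deleted?
      half = subst (λ m → count Chosen? + m ≤ count Deleted?) (sym-permute Chosen?)
        (count-disjoint Deleted? Chosen? (Chosen? ∘ α) (λ _ → proj₁)
          (λ x c → subst (λ y → Within Q y × ¬ G y) (α-invol x) (Deleted-sym (proj₁ c)))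
          (λ x (_ , x≤) (_ , αx≤) → α-nofix x (toℕ-injective (≤-antisym (subst (λ y → toℕ (α x) ≤ toℕ y) (α-invol x) αx≤) x≤))))

    -- Boundary walks of the face classes

    module _ (L : Labelling d) (face : FaceLabelling L) (respects : ∀ x → ¬ G x → Respects L x) (j : Fin (classes L)) where

      -- The boundary of the class `j`: darts with this class on one side only.
      Mixed : Fin d → Set
      Mixed x = label L x ≡ j × label L (α x) ≢ j

      Mixed? : Decidable Mixed
      Mixed? x = label L x ≟ j ×-dec ¬? (label L (α x) ≟ j)

      mixed⇒G : ∀ {x} → Mixed x → G x
      mixed⇒G {x} (e , ≢) = decidable-stable (G? x) λ ¬g → ≢ (trans (sym (respects x ¬g)) e)

      -- Rotating around its head, the boundary of a class can be continued without turning back.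
      mixed-next : ∀ {x} → Mixed x → ∃ λ y → Mixed y × tail y ≡ hd x × y ≢ α x
      mixed-next {x} (e , ≢) with z , tz , ez , ≢z ← rotate (λ z → label L z ≟ j) (tail-φ x) (trans (face x) e) ≢ =
        z , (ez , ≢z ∘ trans (label-σ L face z)) , trans tz (tail-φ x) , λ { refl → ≢ ez }

      -- Without a boundary the label `j` passes across every edge and around every vertex, and
      -- connectedness carries it everywhere.
      all-in-class : (∀ x → ¬ Mixed x) → ∀ x → label L x ≡ j
      all-in-class ¬mixed x with x₀ , e ← onto L j = spread (connected (tail x₀) (tail x)) (λ t → turn (sym t) e) refl
        where
        flip : ∀ {x} → label L x ≡ j → label L (α x) ≡ j
        flip {x} e = decidable-stable (label L (α x) ≟ j) λ ≢ → ¬mixed x (e , ≢)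

        turn : ∀ {x y} → tail x ≡ tail y → label L x ≡ j → label L y ≡ j
        turn {x} {y} t e with k , refl ← σ-transitive x y t = go k
          where
          go : ∀ k → label L (iter σ k x) ≡ j
          go zero    = e
          go (suc k) = trans (label-σ L face _) (flip (go k))

        spread : ∀ {u v} → Reach Adjacent u v → (∀ {y} → tail y ≡ u → label L y ≡ j) → ∀ {y} → tail y ≡ v → label L y ≡ j
        spread here p = p
        spread (step (z , refl , refl) r) p = spread r (λ t → turn (sym t) (flip (p refl)))

      -- A class without boundary contains all of `G`, which has at least `m` darts; otherwise the
      -- boundary walk provides them.
      class-size : ∀ m → m ≤ count G? → (∀ {x} → Mixed x → m ≤ count (λ x → G? x ×-dec label L x ≟ j)) →
        m ≤ count (λ x → G? x ×-dec label L x ≟ j)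
      class-size m m≤G from-mixed with any? Mixed?
      ... | yes (_ , mixed) = from-mixed mixed
      ... | no ¬mixed = ≤-trans m≤G (count-mono G? (λ x → G? x ×-dec label L x ≟ j)
        (λ x g → g , all-in-class (λ x p → ¬mixed (x , p)) x))

      consecutive-≢ : ∀ {x y} → tail y ≡ hd x → y ≢ x
      consecutive-≢ t refl = no-loop _ (sym t)

      -- Returning to `x` after `y` would make `y` parallel to `α x`, hence equal to it.
      no-backtrack : ∀ {x y z} → tail y ≡ hd x → y ≢ α x → tail z ≡ hd y → z ≢ x
      no-backtrack {x} {y} t ≢ t′ refl = ≢ (no-multi y (α x) t (trans (sym t′) (sym (hd-α x))))

      class-size≥3 : ∀ {x} → Mixed x → 3 ≤ count (λ x → G? x ×-dec label L x ≟ j)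
      class-size≥3 mx with y , my , ty , y≢ ← mixed-next mx with z , mz , tz , z≢ ← mixed-next my =
        count≥3 (λ x → G? x ×-dec label L x ≟ j) (mixed⇒G mx , proj₁ mx) (mixed⇒G my , proj₁ my) (mixed⇒G mz , proj₁ mz)
          (consecutive-≢ ty) (no-backtrack ty y≢ tz) (consecutive-≢ tz)

      class-size≥4 : (∀ {x y z} → G x → G y → G z → tail y ≡ hd x → tail z ≡ hd y → hd z ≢ tail x) →
        ∀ {x} → Mixed x → 4 ≤ count (λ x → G? x ×-dec label L x ≟ j)
      class-size≥4 no-triangle mx with y , my , ty , y≢ ← mixed-next mx with z , mz , tz , z≢ ← mixed-next my
        with w , mw , tw , w≢ ← mixed-next mz =
        count≥4 (λ x → G? x ×-dec label L x ≟ j)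
          (mixed⇒G mx , proj₁ mx) (mixed⇒G my , proj₁ my) (mixed⇒G mz , proj₁ mz) (mixed⇒G mw , proj₁ mw)
          (consecutive-≢ ty) (no-backtrack ty y≢ tz)
          -- A walk that returns to its first dart after three steps runs around a triangle.
          (λ { refl → no-triangle (mixed⇒G mx) (mixed⇒G my) (mixed⇒G mz) ty tz (sym tw) })
          (consecutive-≢ tz) (no-backtrack tz z≢ tw) (consecutive-≢ tw)

    planar-bound : ∃ Q → 3 ≤ count G? → count G? + 12 ≤ 6 * count Q?
    planar-bound q 3≤G with L , face , respects , bound ← merge-non-edges q =
      faces-3 (classes L) (count Q?) bound (fibre-bound G? 3 (label L) λ j →
        class-size L face respects j 3 3≤G (class-size≥3 L face respects j))

    triangle-free-bound : (∀ {x y z} → G x → G y → G z → tail y ≡ hd x → tail z ≡ hd y → hd z ≢ tail x) →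
      ∃ Q → 4 ≤ count G? → count G? + 8 ≤ 4 * count Q?
    triangle-free-bound no-triangle q 4≤G with L , face , respects , bound ← merge-non-edges q =
      faces-4 (classes L) (count Q?) bound (fibre-bound G? 4 (label L) λ j →
        class-size L face respects j 4 4≤G (class-size≥4 L face respects j no-triangle))

-- Rainbow-free colourings have few colours

two-sided-arithmetic : ∀ s b q f a → s + s ≤ b → b + 8 ≤ 4 * q → q ≤ f + a → 2 * s + 8 ≤ 4 * (f + a)
two-sided-arithmetic s b q f a h₁ h₂ h₃ = cancel-≤ (b + 4 * q) (h₁ ⊹ h₂ ⊹ 4 ⊛ h₃)
  (solve (s ∷ b ∷ q ∷ f ∷ a ∷ [])) (solve (s ∷ b ∷ q ∷ f ∷ a ∷ []))

-- All inequalities are doubled because darts are counted. The planar bounds fail for graphs with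
-- very few edges, hence the alternatives: `6 ≤ t` absorbs these exceptional cases, together with
-- `3 * t ≤ n + 6` when there are few spokes.
final-arithmetic : ∀ n t k m cov free inside bare spoke a both → 6 ≤ t → 3 * t ≤ n + 6 → suc m ≤ t →
  k * 2 ≤ inside + (bare + bare) → bare ≤ spoke + (both + both) → a + both ≤ m → m * 2 ≤ cov → cov + free ≡ n →
  inside + 12 ≤ 6 * (m * 2) ⊎ inside ≤ 2 → 2 * spoke + 8 ≤ 4 * (free + a) ⊎ spoke ≤ a →
  2 * (k + 14) ≤ 2 * (2 * n + 4 * t)
final-arithmetic _ t k m cov free i b s a τ h₁ h₂ h₃ h₄ h₅ h₆ h₇ refl (inj₁ h₈) (inj₁ h₉) =
  cancel-≤ (i + 2 * b + 2 * s + 4 * a + 4 * τ + 16 * m)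
    (h₄ ⊹ 2 ⊛ h₅ ⊹ h₉ ⊹ 4 ⊛ h₆ ⊹ h₈ ⊹ 8 ⊛ h₃ ⊹ 4 ⊛ h₇)
    (solve (t ∷ k ∷ m ∷ cov ∷ free ∷ i ∷ b ∷ s ∷ a ∷ τ ∷ [])) (solve (t ∷ k ∷ m ∷ cov ∷ free ∷ i ∷ b ∷ s ∷ a ∷ τ ∷ []))
final-arithmetic _ t k m cov free i b s a τ h₁ h₂ h₃ h₄ h₅ h₆ h₇ refl (inj₂ h₈) (inj₁ h₉) =
  cancel-≤ (i + 2 * b + 2 * s + 4 * a + 4 * τ + 8 * m + 28)
    (h₄ ⊹ 2 ⊛ h₅ ⊹ h₉ ⊹ 4 ⊛ h₆ ⊹ h₈ ⊹ 8 ⊛ h₁ ⊹ 4 ⊛ h₇ ⊹ z≤n {26 + 4 * m})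
    (solve (t ∷ k ∷ m ∷ cov ∷ free ∷ i ∷ b ∷ s ∷ a ∷ τ ∷ [])) (solve (t ∷ k ∷ m ∷ cov ∷ free ∷ i ∷ b ∷ s ∷ a ∷ τ ∷ []))
final-arithmetic _ t k m cov free i b s a τ h₁ h₂ h₃ h₄ h₅ h₆ h₇ refl (inj₁ h₈) (inj₂ h₉) =
  cancel-≤ (i + 2 * b + 2 * s + 4 * a + 4 * τ + 16 * m + 12 * t + 24)
    (h₄ ⊹ 2 ⊛ h₅ ⊹ 2 ⊛ h₉ ⊹ 4 ⊛ h₆ ⊹ h₈ ⊹ 16 ⊛ h₃ ⊹ 4 ⊛ h₂ ⊹ 4 ⊛ h₁ ⊹ z≤n {2 * a})
    (solve (t ∷ k ∷ m ∷ cov ∷ free ∷ i ∷ b ∷ s ∷ a ∷ τ ∷ [])) (solve (t ∷ k ∷ m ∷ cov ∷ free ∷ i ∷ b ∷ s ∷ a ∷ τ ∷ []))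
final-arithmetic _ t k m cov free i b s a τ h₁ h₂ h₃ h₄ h₅ h₆ h₇ refl (inj₂ h₈) (inj₂ h₉) =
  cancel-≤ (i + 2 * b + 2 * s + 4 * a + 4 * τ + 4 * m + 3 * t + 18)
    (h₄ ⊹ 2 ⊛ h₅ ⊹ 2 ⊛ h₉ ⊹ 4 ⊛ h₆ ⊹ h₈ ⊹ 4 ⊛ h₃ ⊹ 7 ⊛ h₁ ⊹ h₂ ⊹ z≤n {3 * (cov + free) + 10 + 2 * a})
    (solve (t ∷ k ∷ m ∷ cov ∷ free ∷ i ∷ b ∷ s ∷ a ∷ τ ∷ [])) (solve (t ∷ k ∷ m ∷ cov ∷ free ∷ i ∷ b ∷ s ∷ a ∷ τ ∷ []))

module RainbowFree {n : ℕ} (T : PlaneTriangulation n) {k : ℕ} (c : EdgeColoring T k) where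
  open PlaneTriangulation T
  open EdgeColoring c
  open Planar T using (hd; hd-α; Within; within?; sym-permute; planar-bound; triangle-free-bound)

  rep : Fin k → Fin d
  rep j = proj₁ (col-surj j)

  col-rep : ∀ j → col (rep j) ≡ j
  col-rep j = proj₂ (col-surj j)

  -- The rainbow subgraph with one edge of each colour.
  G : Fin d → Set
  G x = x ≡ rep (col x) ⊎ α x ≡ rep (col x)

  G? : Decidable G
  G? x = (x ≟ rep (col x)) ⊎-dec (α x ≟ rep (col x))

  G-sym : ∀ {x} → G x → G (α x)
  G-sym {x} (inj₁ e) = inj₂ (trans (α-invol x) (trans e (cong rep (sym (col-edge x)))))
  G-sym {x} (inj₂ e) = inj₁ (trans e (cong rep (sym (col-edge x))))

  G-rep : ∀ j → G (rep j)
  G-rep j = inj₁ (cong rep (sym (col-rep j)))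

  colours≤count-G : k * 2 ≤ count G?
  colours≤count-G = fibre-bound G? 2 col λ j → count≥2 (λ x → G? x ×-dec col x ≟ j)
    (G-rep j , col-rep j) (G-sym (G-rep j) , trans (col-edge (rep j)) (col-rep j)) (α-nofix (rep j))

  On : Fin n → Fin d → Set
  On v x = v ≡ tail x ⊎ v ≡ hd x

  On? : ∀ v x → Dec (On v x)
  On? v x = (v ≟ tail x) ⊎-dec (v ≟ hd x)

  On-α : ∀ {v x} → On v x → On v (α x)
  On-α {x = x} (inj₁ e) = inj₂ (trans e (sym (hd-α x)))
  On-α         (inj₂ e) = inj₁ e

  -- Darts of `G` with the same colour belong to the one representative edge of that colour. Hence
  -- every matching in `G` is rainbow.
  G-unique : ∀ {x y v} → G x → G y → col x ≡ col y → On v x → On v y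
  G-unique {x} {y} {v} (inj₁ p) (inj₁ q) e = subst (On v) (trans p (trans (cong rep e) (sym q)))
  G-unique {x} {y} {v} (inj₁ p) (inj₂ q) e = subst (On v) (α-invol y) ∘ On-α ∘ subst (On v) (trans p (trans (cong rep e) (sym q)))
  G-unique {x} {y} {v} (inj₂ p) (inj₁ q) e = subst (On v) (trans p (trans (cong rep e) (sym q))) ∘ On-α
  G-unique {x} {y} {v} (inj₂ p) (inj₂ q) e = subst (On v) (α-invol y) ∘ On-α ∘ subst (On v) (trans p (trans (cong rep e) (sym q))) ∘ On-α

  -- Matchings in the rainbow subgraph and their improvement

  record GMatching (m : ℕ) : Set where
    field
      edge     : Fin m → Fin d
      edge-G   : ∀ i → G (edge i)
      disjoint : ∀ {i j v} → On v (edge i) → On v (edge j) → i ≡ j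

    Covered : Fin n → Set
    Covered v = ∃ λ i → On v (edge i)

    Covered? : Decidable Covered
    Covered? v = any? (λ i → On? v (edge i))

    Extension : Fin d → Set
    Extension x = G x × ¬ Covered (tail x) × ¬ Covered (hd x)

    -- An augmenting path of three edges: the matching edge `i` can be exchanged for `y` and `z`.
    Augmentation : Fin m → Fin d → Fin d → Set
    Augmentation i y z = (G y × tail y ≡ tail (edge i) × ¬ Covered (hd y)) ×
                         (G z × tail z ≡ hd (edge i) × ¬ Covered (hd z)) × hd y ≢ hd z

    Extension? : Decidable Extension
    Extension? x = G? x ×-dec ¬? (Covered? (tail x)) ×-dec ¬? (Covered? (hd x))

    Augmentation? : ∀ i y z → Dec (Augmentation i y z)
    Augmentation? i y z = (G? y ×-dec (tail y ≟ tail (edge i)) ×-dec ¬? (Covered? (hd y))) ×-dec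
                          (G? z ×-dec (tail z ≟ hd (edge i)) ×-dec ¬? (Covered? (hd z))) ×-dec ¬? (hd y ≟ hd z)

    Saturated : Set
    Saturated = (∀ x → ¬ Extension x) × (∀ i y z → ¬ Augmentation i y z)

  open GMatching

  rainbow : ∀ {t} → GMatching t → HasRainbowMatching T c t
  rainbow M = record { e = edge M ; disjoint = λ i j i≢j →
      (λ e → i≢j (disjoint M (inj₁ refl) (inj₁ e))) , (λ e → i≢j (disjoint M (inj₁ refl) (inj₂ e))) ,
      (λ e → i≢j (disjoint M (inj₂ refl) (inj₁ e))) , (λ e → i≢j (disjoint M (inj₂ refl) (inj₂ e))) } ,
    λ i j i≢j e → i≢j (disjoint M (inj₁ refl) (G-unique (edge-G M i) (edge-G M j) e (inj₁ refl)))

  extend : ∀ {m} (M : GMatching m) {x} → Extension M x → GMatching (suc m)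
  extend {m} M {x} (g , ¬t , ¬h) = record { edge = edge′ ; edge-G = edge′-G ; disjoint = λ {i} {j} → disjoint′ i j }
    where
    edge′ : Fin (suc m) → Fin d
    edge′ zero    = x
    edge′ (suc i) = edge M i

    edge′-G : ∀ i → G (edge′ i)
    edge′-G zero    = g
    edge′-G (suc i) = edge-G M i

    new : ∀ {v} → On v x → ¬ Covered M v
    new (inj₁ refl) = ¬t
    new (inj₂ refl) = ¬h

    disjoint′ : ∀ i j {v} → On v (edge′ i) → On v (edge′ j) → i ≡ j
    disjoint′ zero    zero    p q = refl
    disjoint′ zero    (suc j) p q = contradiction (j , q) (new p)
    disjoint′ (suc i) zero    p q = contradiction (i , p) (new q)
    disjoint′ (suc i) (suc j) p q = cong suc (disjoint M p q)

  augment : ∀ {m} (M : GMatching m) {i y z} → Augmentation M i y z → GMatching (suc m)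
  augment {m} M {i} {y} {z} ((gy , ty , ¬hy) , (gz , tz , ¬hz) , hy≢hz) =
    record { edge = edge′ ; edge-G = edge′-G ; disjoint = λ {a} {b} → disjoint′ a b }
    where
    -- `y` takes the place of the edge `i`, and `z` is added in front. The decision is an argument
    -- so that later proofs can match on it.
    edge″ : ∀ j → Dec (j ≡ i) → Fin d
    edge″ j (yes _) = y
    edge″ j (no _)  = edge M j

    edge′ : Fin (suc m) → Fin d
    edge′ zero    = z
    edge′ (suc j) = edge″ j (j ≟ i)

    edge″-G : ∀ j p → G (edge″ j p)
    edge″-G j (yes _) = gy
    edge″-G j (no _)  = edge-G M j

    edge′-G : ∀ j → G (edge′ j)
    edge′-G zero    = gz
    edge′-G (suc j) = edge″-G j (j ≟ i)

    y-new : ∀ {j v} → j ≢ i → On v y → ¬ On v (edge M j)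
    y-new j≢i (inj₁ refl) q = j≢i (disjoint M q (inj₁ ty))
    y-new j≢i (inj₂ refl) q = ¬hy (_ , q)

    z-new : ∀ {j v} → j ≢ i → On v z → ¬ On v (edge M j)
    z-new j≢i (inj₁ refl) q = j≢i (disjoint M q (inj₂ tz))
    z-new j≢i (inj₂ refl) q = ¬hz (_ , q)

    y-z : ∀ {v} → On v y → ¬ On v z
    y-z (inj₁ refl) (inj₁ e) = no-loop (edge M i) (trans (sym tz) (trans (sym e) ty))
    y-z (inj₁ refl) (inj₂ e) = ¬hz (i , inj₁ (trans (sym e) ty))
    y-z (inj₂ refl) (inj₁ e) = ¬hy (i , inj₂ (trans e tz))
    y-z (inj₂ refl) (inj₂ e) = hy≢hz e

    z-old : ∀ {v} j p → On v z → ¬ On v (edge″ j p)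
    z-old j (yes _)  p q = y-z q p
    z-old j (no j≢i) p q = z-new j≢i p q

    disjoint″ : ∀ {v} a b p q → On v (edge″ a p) → On v (edge″ b q) → a ≡ b
    disjoint″ a b (yes refl) (yes refl) p q = refl
    disjoint″ a b (yes refl) (no b≢i)   p q = contradiction q (y-new b≢i p)
    disjoint″ a b (no a≢i)   (yes refl) p q = contradiction p (y-new a≢i q)
    disjoint″ a b (no _)     (no _)     p q = disjoint M p q

    disjoint′ : ∀ a b {v} → On v (edge′ a) → On v (edge′ b) → a ≡ b
    disjoint′ zero    zero    p q = refl
    disjoint′ zero    (suc b) p q = contradiction q (z-old b (b ≟ i) p)
    disjoint′ (suc a) zero    p q = contradiction p (z-old a (a ≟ i) q)
    disjoint′ (suc a) (suc b) p q = cong suc (disjoint″ a b (a ≟ i) (b ≟ i) p q)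

  -- Every improvement adds one edge, and `fuel` is the number of edges missing to `t`; using it up
  -- would yield a rainbow matching.
  saturate : ∀ {t} → ¬ HasRainbowMatching T c t → ∀ fuel {m} → m + fuel ≡ t → GMatching m →
    ∃ λ m → Σ (GMatching m) λ M → Saturated M × m < t
  saturate {t} ¬rainbow zero {m} e M =
    contradiction (rainbow (subst GMatching (trans (sym (+-identityʳ m)) e) M)) ¬rainbow
  saturate ¬rainbow (suc fuel) {m} refl M
    with any? (Extension? M) | any? (λ i → any? λ y → any? λ z → Augmentation? M i y z)
  ... | yes (_ , ext) | _ = saturate ¬rainbow fuel (sym (+-suc m fuel)) (extend M ext)
  ... | no _ | yes (_ , _ , _ , aug) = saturate ¬rainbow fuel (sym (+-suc m fuel)) (augment M aug)
  ... | no ¬ext | no ¬aug =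
    m , M , ((λ x ext → ¬ext (x , ext)) , λ i y z aug → ¬aug (i , y , z , aug)) , m<m+n m (s≤s z≤n)

  empty : GMatching 0
  empty = record { edge = λ () ; edge-G = λ () ; disjoint = λ { {()} } }

  -- Edge counts around a saturated matching

  module _ {m : ℕ} (M : GMatching m) (sat : Saturated M) where

    Free? : Decidable (λ v → ¬ Covered M v)
    Free? = ¬? ∘ Covered? M

    FreeNbr : Fin n → Set
    FreeNbr v = ∃ λ y → G y × tail y ≡ v × ¬ Covered M (hd y)

    FreeNbr? : Decidable FreeNbr
    FreeNbr? v = any? λ y → G? y ×-dec (tail y ≟ v) ×-dec Free? (hd y)

    -- An edge of `G` with two free ends would extend the matching.
    FreeNbr⇒Covered : ∀ {v} → FreeNbr v → Covered M v
    FreeNbr⇒Covered {v} (y , g , refl , ¬h) = decidable-stable (Covered? M v) λ ¬t → proj₁ sat y (g , ¬t , ¬h)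

    Both : Fin m → Set
    Both i = FreeNbr (tail (edge M i)) × FreeNbr (hd (edge M i))

    Both? : Decidable Both
    Both? i = FreeNbr? (tail (edge M i)) ×-dec FreeNbr? (hd (edge M i))

    OnBoth : Fin n → Set
    OnBoth v = ∃ λ i → On v (edge M i) × Both i

    OnBoth? : Decidable OnBoth
    OnBoth? v = any? λ i → On? v (edge M i) ×-dec Both? i

    A : Fin n → Set
    A v = FreeNbr v × ¬ OnBoth v

    A? : Decidable A
    A? v = FreeNbr? v ×-dec ¬? (OnBoth? v)

    covered≥ : m * 2 ≤ count (Covered? M)
    covered≥ = subst (_≤ count (Covered? M)) (sum-const m 2)
      (double-count (λ _ → 2) (λ v → ind (Covered? M v)) (λ i v → ind (On? v (edge M i)))
        (λ i → count≥2 (λ v → On? v (edge M i)) (inj₁ refl) (inj₂ refl) (no-loop (edge M i)))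
        bound)
      where
      bound : ∀ v → count (λ i → On? v (edge M i)) ≤ ind (Covered? M v)
      bound v with any? (λ i → On? v (edge M i))
      ... | yes _ = count-unique (λ i → On? v (edge M i)) (disjoint M)
      ... | no ¬w = ≤-reflexive (count-none (λ i → On? v (edge M i)) λ i p → ¬w (i , p))

    covered≤ : count (Covered? M) ≤ m * 2
    covered≤ = subst (count (Covered? M) ≤_) (sum-const m 2)
      (double-count (λ v → ind (Covered? M v)) (λ _ → 2) (λ v i → ind (On? v (edge M i)))
        (λ v → ind-≤ (Covered? M v) λ (_ , p) → count≥1 (λ i → On? v (edge M i)) p)
        (λ i → ≤-trans (count-⊎ (λ v → On? v (edge M i)) (_≟ tail (edge M i)) (_≟ hd (edge M i)) (λ _ → id))
          (≤-reflexive (cong₂ _+_ (count-singleton (tail (edge M i))) (count-singleton (hd (edge M i)))))))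

    -- Every vertex of `A` lies on a matching edge. An edge outside `Both` holds at most one of
    -- them, and an edge in `Both` holds none.
    A+Both≤ : count A? + count Both? ≤ m
    A+Both≤ = ≤-trans (+-monoˡ-≤ (count Both?) (double-count (λ v → ind (A? v)) (λ i → ind (¬? (Both? i)))
        (λ v i → ind (A? v ×-dec On? v (edge M i)))
        (λ v → ind-≤ (A? v) λ a → let i , p = FreeNbr⇒Covered (proj₁ a) in count≥1 (λ i → A? v ×-dec On? v (edge M i)) (a , p))
        bound))
      (≤-reflexive (trans (+-comm (count (¬? ∘ Both?)) (count Both?)) (count-∁ Both?)))
      where
      bound : ∀ i → count (λ v → A? v ×-dec On? v (edge M i)) ≤ ind (¬? (Both? i))
      bound i = ≤-ind (¬? (Both? i)) id
        (λ ¬both → count-unique (λ v → A? v ×-dec On? v (edge M i)) (unique ¬both))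
        (λ ¬¬both → ≤-reflexive (count-none (λ v → A? v ×-dec On? v (edge M i)) λ v ((_ , ¬on) , p) →
          ¬¬both λ both → ¬on (i , p , both)))
        where
        unique : ¬ Both i → ∀ {v w} → A v × On v (edge M i) → A w × On w (edge M i) → v ≡ w
        unique _ (_ , inj₁ refl) (_ , inj₁ refl) = refl
        unique _ (_ , inj₂ refl) (_ , inj₂ refl) = refl
        unique ¬both ((f , _) , inj₁ refl) ((f′ , _) , inj₂ refl) = contradiction (f , f′) ¬both
        unique ¬both ((f , _) , inj₂ refl) ((f′ , _) , inj₁ refl) = contradiction (f′ , f) ¬both

    Bare : Fin d → Set
    Bare x = G x × ¬ Covered M (tail x)

    Bare? : Decidable Bare
    Bare? x = G? x ×-dec Free? (tail x)

    G-split : count G? ≤ count (within? (Covered? M)) + (count Bare? + count Bare?)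
    G-split = ≤-trans
      (count-⊎ G? (within? (Covered? M)) (λ x → Bare? x ⊎-dec Bare? (α x)) split)
      (+-monoʳ-≤ (count (within? (Covered? M))) (≤-trans
        (count-⊎ (λ x → Bare? x ⊎-dec Bare? (α x)) Bare? (Bare? ∘ α) (λ _ → id))
        (≤-reflexive (cong (count Bare? +_) (sym-permute Bare?)))))
      where
      split : ∀ x → G x → Within (Covered M) x ⊎ Bare x ⊎ Bare (α x)
      split x g with Covered? M (tail x) | Covered? M (hd x)
      ... | yes t | yes h = inj₁ (t , h)
      ... | no ¬t | _     = inj₂ (inj₁ (g , ¬t))
      ... | yes _ | no ¬h = inj₂ (inj₂ (G-sym g , ¬h))

    Spoke : Fin d → Set
    Spoke x = ¬ Covered M (tail x) × A (hd x)

    Spoke? : Decidable Spoke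
    Spoke? x = Free? (tail x) ×-dec A? (hd x)

    BareBoth : Fin d → Set
    BareBoth x = Bare x × OnBoth (hd x)

    BareBoth? : Decidable BareBoth
    BareBoth? x = Bare? x ×-dec OnBoth? (hd x)

    -- If both ends of a matching edge have free neighbours then, for want of an augmentation,
    -- they have only one, which they share.
    bareBoth≤ : count BareBoth? ≤ count Both? + count Both?
    bareBoth≤ = subst (count BareBoth? ≤_) (sum-+ (λ i → ind (Both? i)) (λ i → ind (Both? i)))
      (double-count (λ x → ind (BareBoth? x)) (λ i → ind (Both? i) + ind (Both? i))
        (λ x i → ind (Bare? x ×-dec (On? (hd x) (edge M i) ×-dec Both? i)))
        (λ x → ind-≤ (BareBoth? x) λ (b , i , p) → count≥1 (λ i → Bare? x ×-dec (On? (hd x) (edge M i) ×-dec Both? i)) (b , p))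
        bound)
      where
      bound : ∀ i → count (λ x → Bare? x ×-dec (On? (hd x) (edge M i) ×-dec Both? i)) ≤ ind (Both? i) + ind (Both? i)
      bound i = ≤-ind (Both? i) (λ b → b + b)
        (λ both → ≤-trans
          (count-⊎ (λ x → Bare? x ×-dec (On? (hd x) (edge M i) ×-dec Both? i)) AtTail? AtHead?
            λ { x (b , inj₁ e , _) → inj₁ (b , e) ; x (b , inj₂ e , _) → inj₂ (b , e) })
          (+-mono-≤ (count-unique AtTail? λ p q → no-multi _ _ (trans (tail-end both p) (sym (tail-end both q))) (trans (proj₂ p) (sym (proj₂ q))))
                    (count-unique AtHead? λ p q → no-multi _ _ (trans (head-end both p) (sym (head-end both q))) (trans (proj₂ p) (sym (proj₂ q))))))
        (λ ¬both → ≤-reflexive (count-none (λ x → Bare? x ×-dec (On? (hd x) (edge M i) ×-dec Both? i)) λ x p → ¬both (proj₂ (proj₂ p))))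
        where
        AtTail? : Decidable (λ x → Bare x × hd x ≡ tail (edge M i))
        AtTail? x = Bare? x ×-dec (hd x ≟ tail (edge M i))

        AtHead? : Decidable (λ x → Bare x × hd x ≡ hd (edge M i))
        AtHead? x = Bare? x ×-dec (hd x ≟ hd (edge M i))

        tail-end : (both : Both i) → ∀ {x} → Bare x × hd x ≡ tail (edge M i) → tail x ≡ hd (proj₁ (proj₂ both))
        tail-end (_ , z , gz , tz , ¬hz) {x} ((g , ¬t) , e) = decidable-stable (tail x ≟ hd z) λ ≢ → proj₂ sat i (α x) z
          ((G-sym g , e , ¬t ∘ subst (Covered M) (hd-α x)) , (gz , tz , ¬hz) , ≢ ∘ trans (sym (hd-α x)))

        head-end : (both : Both i) → ∀ {x} → Bare x × hd x ≡ hd (edge M i) → tail x ≡ hd (proj₁ (proj₁ both))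
        head-end ((y , gy , ty , ¬hy) , _) {x} ((g , ¬t) , e) = decidable-stable (tail x ≟ hd y) λ ≢ → proj₂ sat i y (α x)
          ((gy , ty , ¬hy) , (G-sym g , e , ¬t ∘ subst (Covered M) (hd-α x)) , λ e → ≢ (sym (trans e (hd-α x))))

    bare≤ : count Bare? ≤ count Spoke? + (count Both? + count Both?)
    bare≤ = ≤-trans (count-⊎ Bare? Spoke? BareBoth? split) (+-monoʳ-≤ (count Spoke?) bareBoth≤)
      where
      split : ∀ x → Bare x → Spoke x ⊎ BareBoth x
      split x (g , ¬t) with OnBoth? (hd x)
      ... | yes on = inj₂ ((g , ¬t) , on)
      ... | no ¬on = inj₁ (¬t , (α x , G-sym g , refl , ¬t ∘ subst (Covered M) (hd-α x)) , ¬on)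

    -- The planar bound is applied to all edges of `T` between covered vertices; it requires three
    -- darts, so two or fewer are treated apart.
    inside-bound : count (within? (Covered? M)) + 12 ≤ 6 * (m * 2) ⊎ count (within? (Covered? M)) ≤ 2
    inside-bound with 3 ≤? count (within? (Covered? M))
    ... | no ¬3≤ = inj₂ (s≤s⁻¹ (≰⇒> ¬3≤))
    ... | yes 3≤ with x , t , _ ← count-witness (within? (Covered? M)) (≤-trans (s≤s z≤n) 3≤) =
      inj₁ (≤-trans (planar-bound (Covered? M) (within? (Covered? M))
        (λ {x} (t , h) → h , subst (Covered M) (sym (hd-α x)) t) id (tail x , t) 3≤) (*-monoʳ-≤ 6 covered≤))

    TwoSided : Fin d → Set
    TwoSided x = Spoke x ⊎ Spoke (α x)

    TwoSided? : Decidable TwoSided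
    TwoSided? x = Spoke? x ⊎-dec Spoke? (α x)

    spokes : count Spoke? + count Spoke? ≤ count TwoSided?
    spokes = subst (λ m → count Spoke? + m ≤ count TwoSided?) (sym-permute Spoke?)
      (count-disjoint TwoSided? Spoke? (Spoke? ∘ α) (λ _ → inj₁) (λ _ → inj₂)
        λ x (¬t , _) (_ , a) → ¬t (subst (Covered M) (hd-α x) (FreeNbr⇒Covered (proj₁ a))))

    Q : Fin n → Set
    Q v = ¬ Covered M v ⊎ A v

    Q? : Decidable Q
    Q? v = Free? v ⊎-dec A? v

    Alternating : Fin d → Set
    Alternating x = (¬ Covered M (tail x) × Covered M (hd x)) ⊎ (Covered M (tail x) × ¬ Covered M (hd x))

    alternating : ∀ {x} → TwoSided x → Alternating x
    alternating {x} (inj₁ (¬t , a)) = inj₁ (¬t , FreeNbr⇒Covered (proj₁ a))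
    alternating {x} (inj₂ (¬h , a)) = inj₂ (subst (Covered M) (hd-α x) (FreeNbr⇒Covered (proj₁ a)) , ¬h)

    TwoSided-sym : ∀ {x} → TwoSided x → TwoSided (α x)
    TwoSided-sym {x} (inj₁ (¬t , a)) = inj₂ (¬t ∘ subst (Covered M) (hd-α x) , subst (A ∘ hd) (sym (α-invol x)) a)
    TwoSided-sym {x} (inj₂ p) = inj₁ p

    TwoSided-ends : ∀ {x} → TwoSided x → Within Q x
    TwoSided-ends (inj₁ (¬t , a)) = inj₁ ¬t , inj₂ a
    TwoSided-ends {x} (inj₂ (¬h , a)) = inj₂ (subst A (hd-α x) a) , inj₁ ¬h

    -- Covered and free vertices alternate along a walk, which therefore cannot close up after three
    -- steps.
    no-triangle : ∀ {x y z} → Alternating x → Alternating y → Alternating z →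
      tail y ≡ hd x → tail z ≡ hd y → hd z ≢ tail x
    no-triangle (inj₁ (_ , h)) (inj₁ (¬t , _)) _ e _ _ = ¬t (subst (Covered M) (sym e) h)
    no-triangle (inj₂ (_ , ¬h)) (inj₂ (t , _)) _ e _ _ = ¬h (subst (Covered M) e t)
    no-triangle _ (inj₁ (_ , h)) (inj₁ (¬t , _)) _ e _ = ¬t (subst (Covered M) (sym e) h)
    no-triangle _ (inj₂ (_ , ¬h)) (inj₂ (t , _)) _ e _ = ¬h (subst (Covered M) e t)
    no-triangle (inj₁ (¬t , _)) _ (inj₁ (_ , h)) _ _ e = ¬t (subst (Covered M) e h)
    no-triangle (inj₂ (t , _)) _ (inj₂ (_ , ¬h)) _ _ e = ¬h (subst (Covered M) (sym e) t)

    -- Each spoke gives two darts, so fewer than four darts leave at most one spoke, and the head of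
    -- a spoke lies in `A`.
    spoke-bound : 2 * count Spoke? + 8 ≤ 4 * (count Free? + count A?) ⊎ count Spoke? ≤ count A?
    spoke-bound with 4 ≤? count TwoSided?
    ... | yes 4≤ with x , p ← count-witness TwoSided? (≤-trans (s≤s z≤n) 4≤) =
      inj₁ (two-sided-arithmetic (count Spoke?) (count TwoSided?) (count Q?) (count Free?) (count A?) spokes
        (triangle-free-bound Q? TwoSided? TwoSided-sym TwoSided-ends
          (λ p q r → no-triangle (alternating p) (alternating q) (alternating r)) (tail x , proj₁ (TwoSided-ends p)) 4≤)
        (count-⊎ Q? Free? A? (λ _ → id)))
    ... | no ¬4≤ with 1 ≤? count Spoke?
    ...   | no ¬1≤ = inj₂ (≤-trans (s≤s⁻¹ (≰⇒> ¬1≤)) z≤n)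
    ...   | yes 1≤ with x , _ , a ← count-witness Spoke? 1≤ =
      inj₂ (≤-trans (s≤s⁻¹ (≰⇒> λ 2≤ → ¬4≤ (≤-trans (2≤ ⊹ 2≤) spokes))) (count≥1 A? a))

  upper-bound : ∀ t → 6 ≤ t → 3 * t ≤ n + 6 → ¬ HasRainbowMatching T c t → k ≤ 2 * n + 4 * t ∸ 14
  upper-bound t 6≤t 3t≤n+6 ¬rainbow with m , M , sat , m<t ← saturate ¬rainbow t refl empty =
    m+n≤o⇒m≤o∸n k {o = 2 * n + 4 * t} (*-cancelˡ-≤ 2 (final-arithmetic n t k m (count (Covered? M)) (count (Free? M sat))
      (count (within? (Covered? M))) (count (Bare? M sat)) (count (Spoke? M sat)) (count (A? M sat)) (count (Both? M sat))
      6≤t 3t≤n+6 m<t (≤-trans colours≤count-G (G-split M sat)) (bare≤ M sat) (A+Both≤ M sat)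
      (covered≥ M sat) (count-∁ (Covered? M)) (inside-bound M sat) (spoke-bound M sat)))

-- Stacked triangulations

-- Darts form an arbitrary finite type, so that a stacked map can use a disjoint sum. The face
-- permutation `φ` is primitive, and rotation around a vertex is `φ ∘ α`.
record TriMap (n : ℕ) : Set₁ where
  field
    Dart      : Set
    {size}    : ℕ
    enum      : Dart ↔ Fin size
    tail      : Dart → Fin n
    α φ       : Dart → Dart
    α-invol   : ∀ x → α (α x) ≡ x
    φ³        : ∀ x → φ (φ (φ x)) ≡ x
    tail-φ    : ∀ x → tail (φ x) ≡ tail (α x)
    orbit     : ∀ x y → tail x ≡ tail y → ∃ λ k → iter (φ ∘ α) k x ≡ y
    no-loop   : ∀ x → tail (α x) ≢ tail x
    no-multi  : ∀ x y → tail x ≡ tail y → tail (α x) ≡ tail (α y) → x ≡ y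
    connected : ∀ u v → Reach (λ a b → ∃ λ x → tail x ≡ a × tail (α x) ≡ b) u v
    euler     : Σ ℕ λ E → Σ ℕ λ F → (2 * E ≡ size) × (3 * F ≡ size) × (n + F ≡ E + 2)

  hd : Dart → Fin n
  hd x = tail (α x)

  third : Dart → Fin n
  third x = tail (φ (φ x))

  Adjacent : Fin n → Fin n → Set
  Adjacent a b = ∃ λ x → tail x ≡ a × hd x ≡ b

  _≟ᵈ_ : (x y : Dart) → Dec (x ≡ y)
  x ≟ᵈ y = map′ injective (cong (Inverse.to enum)) (Inverse.to enum x ≟ Inverse.to enum y)
    where
    injective : Inverse.to enum x ≡ Inverse.to enum y → x ≡ y
    injective e = trans (sym (Inverse.strictlyInverseʳ enum x)) (trans (cong (Inverse.from enum) e) (Inverse.strictlyInverseʳ enum y))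

next prev : Fin 3 → Fin 3
next 0F = 1F
next 1F = 2F
next 2F = 0F
prev 0F = 2F
prev 1F = 0F
prev 2F = 1F

prev-next : ∀ i → prev (next i) ≡ i
prev-next 0F = refl
prev-next 1F = refl
prev-next 2F = refl

next-prev : ∀ i → next (prev i) ≡ i
next-prev 0F = refl
next-prev 1F = refl
next-prev 2F = refl

iter-+ : ∀ {A : Set} (f : A → A) j k x → iter f j (iter f k x) ≡ iter f (j + k) x
iter-+ f zero    k x = refl
iter-+ f (suc j) k x = cong f (iter-+ f j k x)

-- Darts after stacking: from the new vertex to a corner, from a corner to the new vertex, and the
-- previous ones.
pattern out i = inj₁ i
pattern inn i = inj₂ (inj₁ i)
pattern old x = inj₂ (inj₂ x)

-- A new vertex inside the face containing the dart x, joined to its three corners.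
module Stack {n : ℕ} (K : TriMap n) (x : TriMap.Dart K) where
  open TriMap K

  corner : Fin 3 → Dart
  corner 0F = x
  corner 1F = φ x
  corner 2F = φ (φ x)

  φ-corner : ∀ i → φ (corner i) ≡ corner (next i)
  φ-corner 0F = refl
  φ-corner 1F = refl
  φ-corner 2F = φ³ x

  tail-corner-next : ∀ i → tail (corner (next i)) ≡ hd (corner i)
  tail-corner-next i = trans (cong tail (sym (φ-corner i))) (tail-φ (corner i))

  tail-corner≢next : ∀ i → tail (corner (next i)) ≢ tail (corner i)
  tail-corner≢next i e = no-loop (corner i) (trans (sym (tail-corner-next i)) e)

  tail-corner-injective : ∀ i j → tail (corner i) ≡ tail (corner j) → i ≡ j
  tail-corner-injective 0F 0F e = refl
  tail-corner-injective 0F 1F e = contradiction (sym e) (tail-corner≢next 0F)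
  tail-corner-injective 0F 2F e = contradiction e (tail-corner≢next 2F)
  tail-corner-injective 1F 0F e = contradiction e (tail-corner≢next 0F)
  tail-corner-injective 1F 1F e = refl
  tail-corner-injective 1F 2F e = contradiction (sym e) (tail-corner≢next 1F)
  tail-corner-injective 2F 0F e = contradiction (sym e) (tail-corner≢next 2F)
  tail-corner-injective 2F 1F e = contradiction e (tail-corner≢next 1F)
  tail-corner-injective 2F 2F e = refl

  OnFace : Dart → Set
  OnFace w = ∃ λ i → w ≡ corner i

  OnFace? : ∀ w → Dec (OnFace w)
  OnFace? w = any? (λ i → w ≟ᵈ corner i)

  OnFace-φ : ∀ {w} → OnFace (φ w) → OnFace w
  OnFace-φ {w} (i , e) = next (next i) , trans (sym (φ³ w)) (trans (cong (φ ∘ φ) e) (trans (cong φ (φ-corner i)) (φ-corner (next i))))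

  Dart′ : Set
  Dart′ = Fin 3 ⊎ Fin 3 ⊎ Dart

  tail′ : Dart′ → Fin (suc n)
  tail′ (out i) = zero
  tail′ (inn i) = suc (tail (corner i))
  tail′ (old w) = suc (tail w)

  α′ : Dart′ → Dart′
  α′ (out i) = inn i
  α′ (inn i) = out i
  α′ (old w) = old (α w)

  φ-old : ∀ {w} → Dec (OnFace w) → Dart′
  φ-old {w} (yes (i , _)) = inn (next i)
  φ-old {w} (no _)        = old (φ w)

  -- The new faces are the cycles `out i`, `old (corner i)`, `inn (next i)`; the other faces are
  -- unchanged.
  φ′ : Dart′ → Dart′
  φ′ (out i) = old (corner i)
  φ′ (inn i) = out (prev i)
  φ′ (old w) = φ-old (OnFace? w)

  φ′-corner : ∀ {w} i → w ≡ corner i → φ′ (old w) ≡ inn (next i)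
  φ′-corner {w} i e with OnFace? w
  ... | yes (j , e′) = cong (λ i → inn (next i)) (tail-corner-injective j i (cong tail (trans (sym e′) e)))
  ... | no ¬on       = contradiction (i , e) ¬on

  φ′-off : ∀ {w} → ¬ OnFace w → φ′ (old w) ≡ old (φ w)
  φ′-off {w} ¬on with OnFace? w
  ... | yes on = contradiction on ¬on
  ... | no _   = refl

  φ′φ′-corner : ∀ {w} i → w ≡ corner i → φ′ (φ′ (old w)) ≡ out i
  φ′φ′-corner i e = trans (cong φ′ (φ′-corner i e)) (cong out (prev-next i))

  φ′φ′-off : ∀ {w} → ¬ OnFace w → φ′ (φ′ (old w)) ≡ old (φ (φ w))
  φ′φ′-off ¬on = trans (cong φ′ (φ′-off ¬on)) (φ′-off (¬on ∘ OnFace-φ))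

  φ′³ : ∀ w → φ′ (φ′ (φ′ w)) ≡ w
  φ′³ (out i) = φ′φ′-corner i refl
  φ′³ (inn i) = trans (φ′-corner (prev i) refl) (cong inn (next-prev i))
  φ′³ (old w) with OnFace? w
  ... | yes (i , refl) = cong (λ i → old (corner i)) (prev-next i)
  ... | no ¬on = trans (φ′φ′-off (¬on ∘ OnFace-φ)) (cong old (φ³ w))

  tail′-φ′ : ∀ w → tail′ (φ′ w) ≡ tail′ (α′ w)
  tail′-φ′ (out i) = refl
  tail′-φ′ (inn i) = refl
  tail′-φ′ (old w) with OnFace? w
  ... | yes (i , refl) = cong suc (tail-corner-next i)
  ... | no _           = cong suc (tail-φ w)

  α′-invol : ∀ w → α′ (α′ w) ≡ w
  α′-invol (out i) = refl
  α′-invol (inn i) = refl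
  α′-invol (old w) = cong old (α-invol w)

  no-loop′ : ∀ w → tail′ (α′ w) ≢ tail′ w
  no-loop′ (old w) e = no-loop w (suc-injective e)

  no-multi′ : ∀ v w → tail′ v ≡ tail′ w → tail′ (α′ v) ≡ tail′ (α′ w) → v ≡ w
  no-multi′ (out i) (out j) _ h = cong out (tail-corner-injective i j (suc-injective h))
  no-multi′ (out i) (inn j) ()
  no-multi′ (out i) (old w) ()
  no-multi′ (inn i) (inn j) t _ = cong inn (tail-corner-injective i j (suc-injective t))
  no-multi′ (old v) (old w) t h = cong old (no-multi v w (suc-injective t) (suc-injective h))

  σ′ : Dart′ → Dart′
  σ′ = φ′ ∘ α′

  Orbit : Dart′ → Dart′ → Set
  Orbit v w = ∃ λ k → iter σ′ k v ≡ w

  orbit-trans : ∀ {u v w} → Orbit u v → Orbit v w → Orbit u w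
  orbit-trans (j , refl) (k , refl) = k + j , sym (iter-+ σ′ k j _)

  -- At a corner the new dart is inserted between two consecutive old ones, and one rotation step
  -- becomes two.
  orbit-old : ∀ w → Orbit (old w) (old (φ (α w)))
  orbit-old w with OnFace? (α w) in eq
  ... | yes (i , e) = 2 , trans (cong σ′ (φ′-corner i e)) (cong old (trans (sym (φ-corner i)) (cong φ (sym e))))
  ... | no ¬on      = 1 , φ′-off ¬on

  orbit-iter : ∀ k w → Orbit (old w) (old (iter (φ ∘ α) k w))
  orbit-iter zero    w = 0 , refl
  orbit-iter (suc k) w = orbit-trans (orbit-iter k w) (orbit-old _)

  orbit-old-old : ∀ v w → tail v ≡ tail w → Orbit (old v) (old w)
  orbit-old-old v w t with k , refl ← orbit v w t = orbit-iter k v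

  orbit-inn : ∀ i → Orbit (inn i) (old (corner i))
  orbit-inn i = 1 , refl

  -- The old dart that precedes `inn i` in the rotation around its corner.
  before-inn : Fin 3 → Dart
  before-inn i = α (corner (prev i))

  orbit-before-inn : ∀ i → Orbit (old (before-inn i)) (inn i)
  orbit-before-inn i = 1 , trans (φ′-corner (prev i) (α-invol _)) (cong inn (next-prev i))

  tail-before-inn : ∀ i → tail (before-inn i) ≡ tail (corner i)
  tail-before-inn i = trans (sym (tail-corner-next (prev i))) (cong (tail ∘ corner) (next-prev i))

  orbit-out : ∀ i j → Orbit (out i) (out j)
  orbit-out 0F 0F = 0 , refl
  orbit-out 0F 1F = 2 , refl
  orbit-out 0F 2F = 1 , refl
  orbit-out 1F 0F = 1 , refl
  orbit-out 1F 1F = 0 , refl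
  orbit-out 1F 2F = 2 , refl
  orbit-out 2F 0F = 2 , refl
  orbit-out 2F 1F = 1 , refl
  orbit-out 2F 2F = 0 , refl

  orbit′ : ∀ v w → tail′ v ≡ tail′ w → Orbit v w
  orbit′ (out i) (out j) t = orbit-out i j
  orbit′ (out i) (inn j) ()
  orbit′ (out i) (old w) ()
  orbit′ (inn i) (inn j) t = orbit-trans (orbit-inn i) (orbit-trans
    (orbit-old-old (corner i) (before-inn j) (trans (suc-injective t) (sym (tail-before-inn j)))) (orbit-before-inn j))
  orbit′ (inn i) (old w) t = orbit-trans (orbit-inn i) (orbit-old-old (corner i) w (suc-injective t))
  orbit′ (old v) (inn j) t = orbit-trans (orbit-old-old v (before-inn j) (trans (suc-injective t) (sym (tail-before-inn j)))) (orbit-before-inn j)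
  orbit′ (old v) (old w) t = orbit-old-old v w (suc-injective t)

  Adjacent′ : Fin (suc n) → Fin (suc n) → Set
  Adjacent′ a b = ∃ λ w → tail′ w ≡ a × tail′ (α′ w) ≡ b

  reach-old : ∀ {u v} → Reach Adjacent u v → Reach Adjacent′ (suc u) (suc v)
  reach-old here = here
  reach-old (step (w , t , h) r) = step (old w , cong suc t , cong suc h) (reach-old r)

  reach-snoc : ∀ {u v w} → Reach Adjacent′ u v → Adjacent′ v w → Reach Adjacent′ u w
  reach-snoc here       b = step b here
  reach-snoc (step a r) b = step a (reach-snoc r b)

  connected′ : ∀ u v → Reach Adjacent′ u v
  connected′ zero    zero    = here
  connected′ zero    (suc v) = step (out 0F , refl , refl) (reach-old (connected (tail x) v))
  connected′ (suc u) zero    = reach-snoc (reach-old (connected u (tail x))) (inn 0F , refl , refl)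
  connected′ (suc u) (suc v) = reach-old (connected u v)

  euler′ : Σ ℕ λ E → Σ ℕ λ F → (2 * E ≡ 3 + (3 + size)) × (3 * F ≡ 3 + (3 + size)) × (suc n + F ≡ E + 2)
  euler′ with E , F , 2E≡d , 3F≡d , χ ← euler =
    3 + E , 2 + F , trans (*-distribˡ-+ 2 3 E) (cong (6 +_) 2E≡d) , trans (*-distribˡ-+ 3 2 F) (cong (6 +_) 3F≡d) ,
    cong suc (trans (+-suc n (suc F)) (cong suc (trans (+-suc n F) (cong suc χ))))

  stack : TriMap (suc n)
  stack = record
    { Dart = Dart′
    ; enum = ↔-sym +↔⊎ ↔-∘ (↔-id (Fin 3) ⊎-↔ (↔-sym +↔⊎ ↔-∘ (↔-id (Fin 3) ⊎-↔ enum)))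
    ; tail = tail′ ; α = α′ ; φ = φ′ ; α-invol = α′-invol ; φ³ = φ′³ ; tail-φ = tail′-φ′ ; orbit = orbit′
    ; no-loop = no-loop′ ; no-multi = no-multi′ ; connected = connected′ ; euler = euler′ }

  third-corner : ∀ {w} → OnFace w → TriMap.third stack (old w) ≡ zero
  third-corner (i , e) = cong tail′ (φ′φ′-corner i e)

  third-off : ∀ {w} → ¬ OnFace w → TriMap.third stack (old w) ≡ suc (third w)
  third-off ¬on = cong tail′ (φ′φ′-off ¬on)

module _ {n : ℕ} (K : TriMap n) (x : TriMap.Dart K) where
  open Stack K x

  OnFace-off : ∀ {v w} → ¬ OnFace v → Stack.OnFace stack (old v) (old w) → Stack.OnFace K v w
  OnFace-off ¬on (0F , refl) = 0F , refl
  OnFace-off ¬on (1F , e) with refl ← trans e (φ′-off ¬on) = 1F , refl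
  OnFace-off ¬on (2F , e) with refl ← trans e (φ′φ′-off ¬on) = 2F , refl

  -- The three sides of the subdivided face end up in three different faces.
  OnFace-corner : ∀ {v w} → OnFace v → Stack.OnFace stack (old v) (old w) → w ≡ v
  OnFace-corner _ (0F , refl) = refl
  OnFace-corner (i , p) (1F , e) with () ← trans e (φ′-corner i p)
  OnFace-corner (i , p) (2F , e) with () ← trans e (φ′φ′-corner i p)

open Stack using (stack; OnFace; third-corner; third-off)

-- Colourings and matchings carried along by stacking

module _ {n : ℕ} (K : TriMap n) where
  open TriMap K

  -- Colour 0 is the colour shared by all the edges that avoid the hubs; it need not occur yet.
  record HubColouring (k s : ℕ) : Set where
    field
      colour      : Dart → ℕ
      colour-α    : ∀ x → colour (α x) ≡ colour x
      colour≤     : ∀ x → colour x ≤ k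
      colour-onto : ∀ {c} → 1 ≤ c → c ≤ k → ∃ λ x → colour x ≡ c
      hub         : Fin s → Fin n

    Hub : Fin n → Set
    Hub v = ∃ λ j → hub j ≡ v

    field
      covered : ∀ x → colour x ≡ 0 ⊎ Hub (tail x) ⊎ Hub (hd x)

  OnDart : Fin n → Dart → Set
  OnDart v x = v ≡ tail x ⊎ v ≡ hd x

  record MapMatching (m : ℕ) : Set where
    field
      edge     : Fin m → Dart
      disjoint : ∀ i j {v} → OnDart v (edge i) → OnDart v (edge j) → i ≡ j

    Unmatched : Fin n → Set
    Unmatched v = ∀ i → ¬ OnDart v (edge i)

  module _ {m : ℕ} (M : MapMatching m) where
    open MapMatching M

    edge-∷ : Dart → Fin (suc m) → Dart
    edge-∷ x zero    = x
    edge-∷ x (suc i) = edge i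

    add-edge : ∀ x → Unmatched (tail x) → Unmatched (hd x) → MapMatching (suc m)
    add-edge x ¬t ¬h = record { edge = edge-∷ x ; disjoint = disjoint′ }
      where
      new : ∀ {v} → OnDart v x → Unmatched v
      new (inj₁ refl) = ¬t
      new (inj₂ refl) = ¬h

      disjoint′ : ∀ i j {v} → OnDart v (edge-∷ x i) → OnDart v (edge-∷ x j) → i ≡ j
      disjoint′ zero    zero    p q = refl
      disjoint′ zero    (suc j) p q = contradiction q (new p j)
      disjoint′ (suc i) zero    p q = contradiction p (new q i)
      disjoint′ (suc i) (suc j) p q = cong suc (disjoint i j p q)

    unmatched-add : ∀ {x v} → Unmatched v → v ≢ tail x → v ≢ hd x → ∀ i → ¬ OnDart v (edge-∷ x i)
    unmatched-add ¬v v≢t v≢h zero    = [ v≢t , v≢h ]′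
    unmatched-add ¬v v≢t v≢h (suc i) = ¬v i

open HubColouring
open MapMatching

module _ {n : ℕ} (K : TriMap n) (x : TriMap.Dart K) where
  open TriMap K
  open Stack K x using (corner)

  lift-matching : ∀ {m} → MapMatching K m → MapMatching (stack K x) m
  lift-matching M = record { edge = λ i → old (edge M i) ; disjoint = λ i j p q → disjoint′ i j p q }
    where
    disjoint′ : ∀ i j {v} → OnDart (stack K x) v (old (edge M i)) → OnDart (stack K x) v (old (edge M j)) → i ≡ j
    disjoint′ i j {zero}  (inj₁ ()) q
    disjoint′ i j {zero}  (inj₂ ()) q
    disjoint′ i j {suc v} p q = disjoint M i j (Sum.map suc-injective suc-injective p) (Sum.map suc-injective suc-injective q)

  unmatched-new : ∀ {m} (M : MapMatching K m) → Unmatched (lift-matching M) zero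
  unmatched-new M i (inj₁ ())
  unmatched-new M i (inj₂ ())

  unmatched-lift : ∀ {m} (M : MapMatching K m) {v} → Unmatched M v → Unmatched (lift-matching M) (suc v)
  unmatched-lift M ¬v i p = ¬v i (Sum.map suc-injective suc-injective p)

  module _ {k s} (C : HubColouring K k s) where

    -- `fresh i` colours the edge from the new vertex to the corner `i`; the old edges keep their
    -- colours.
    stack-colouring : ∀ {k′ s′} (fresh : Fin 3 → ℕ) (hub′ : Fin s′ → Fin (suc n)) →
      k ≤ k′ → (∀ i → fresh i ≤ k′) → (∀ {c} → k < c → c ≤ k′ → ∃ λ i → fresh i ≡ c) →
      (∀ {v} → Hub C v → ∃ λ j → hub′ j ≡ suc v) →
      (∀ i → fresh i ≡ 0 ⊎ (∃ λ j → hub′ j ≡ zero) ⊎ (∃ λ j → hub′ j ≡ suc (tail (corner i)))) →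
      HubColouring (stack K x) k′ s′
    stack-colouring {k′} fresh hub′ k≤k′ fresh≤ fresh-onto hub-old fresh-covered = record
      { colour = colour′ ; colour-α = colour′-α ; colour≤ = colour′≤ ; colour-onto = colour′-onto
      ; hub = hub′ ; covered = covered′ }
      where
      colour′ : TriMap.Dart (stack K x) → ℕ
      colour′ (out i) = fresh i
      colour′ (inn i) = fresh i
      colour′ (old w) = colour C w

      colour′-α : ∀ w → colour′ (TriMap.α (stack K x) w) ≡ colour′ w
      colour′-α (out i) = refl
      colour′-α (inn i) = refl
      colour′-α (old w) = colour-α C w

      colour′≤ : ∀ w → colour′ w ≤ k′
      colour′≤ (out i) = fresh≤ i
      colour′≤ (inn i) = fresh≤ i
      colour′≤ (old w) = ≤-trans (colour≤ C w) k≤k′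

      colour′-onto : ∀ {c} → 1 ≤ c → c ≤ k′ → ∃ λ w → colour′ w ≡ c
      colour′-onto {c} 1≤c c≤k′ with c ≤? k
      ... | yes c≤k = let w , e = colour-onto C 1≤c c≤k in old w , e
      ... | no c≰k  = let i , e = fresh-onto (≰⇒> c≰k) c≤k′ in out i , e

      covered′ : ∀ w → colour′ w ≡ 0 ⊎ (∃ λ j → hub′ j ≡ TriMap.tail (stack K x) w) ⊎ (∃ λ j → hub′ j ≡ TriMap.hd (stack K x) w)
      covered′ (out i) = fresh-covered i
      covered′ (inn i) = Sum.map₂ Sum.swap (fresh-covered i)
      covered′ (old w) = Sum.map₂ (Sum.map hub-old hub-old) (covered C w)

    three-fresh : Fin 3 → ℕ
    three-fresh i = suc (toℕ i + k)

    three-fresh≤ : ∀ i → three-fresh i ≤ 3 + k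
    three-fresh≤ i = +-monoˡ-≤ k (toℕ<n i)

    three-fresh-onto : ∀ {c} → k < c → c ≤ 3 + k → ∃ λ i → three-fresh i ≡ c
    three-fresh-onto k<c c≤ with m≤n⇒m<n∨m≡n c≤
    ... | inj₂ refl = 2F , refl
    ... | inj₁ (s≤s c≤) with m≤n⇒m<n∨m≡n c≤
    ...   | inj₂ refl = 1F , refl
    ...   | inj₁ (s≤s c≤) = 0F , ≤-antisym k<c c≤

    stack-hub : HubColouring (stack K x) (3 + k) (suc s)
    stack-hub = stack-colouring three-fresh hub′ (m≤n+m k 3) three-fresh≤ three-fresh-onto
      (λ (j , e) → suc j , cong suc e) (λ i → inj₂ (inj₁ (zero , refl)))
      where
      hub′ : Fin (suc s) → Fin (suc n)
      hub′ zero    = zero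
      hub′ (suc j) = suc (hub C j)

    HubFace : Set
    HubFace = Hub C (tail x) × Hub C (hd x) × Hub C (third x)

    stack-leaf : HubFace → HubColouring (stack K x) (3 + k) s
    stack-leaf (ht , hh , h3) = stack-colouring three-fresh (suc ∘ hub C) (m≤n+m k 3) three-fresh≤ three-fresh-onto
      (map₂ (cong suc)) (λ i → inj₂ (inj₂ (map₂ (cong suc) (corner-hub i))))
      where
      corner-hub : ∀ i → Hub C (tail (corner i))
      corner-hub 0F = ht
      corner-hub 1F = subst (Hub C) (sym (tail-φ x)) hh
      corner-hub 2F = h3

    -- Only the first two corners are known to be hubs, so the third new edge takes the shared
    -- colour 0 and just two colours are added.
    stack-shared : Hub C (tail x) → Hub C (hd x) → HubColouring (stack K x) (2 + k) s
    stack-shared ht hh = stack-colouring fresh (suc ∘ hub C) (m≤n+m k 2) fresh≤ fresh-onto (map₂ (cong suc)) fresh-covered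
      where
      fresh : Fin 3 → ℕ
      fresh 0F = 1 + k
      fresh 1F = 2 + k
      fresh 2F = 0

      fresh≤ : ∀ i → fresh i ≤ 2 + k
      fresh≤ 0F = n≤1+n _
      fresh≤ 1F = ≤-refl
      fresh≤ 2F = z≤n

      fresh-onto : ∀ {c} → k < c → c ≤ 2 + k → ∃ λ i → fresh i ≡ c
      fresh-onto k<c c≤ with m≤n⇒m<n∨m≡n c≤
      ... | inj₂ refl = 1F , refl
      ... | inj₁ (s≤s c≤) = 0F , ≤-antisym k<c c≤

      fresh-covered : ∀ i → fresh i ≡ 0 ⊎ (∃ λ j → suc (hub C j) ≡ zero) ⊎ (∃ λ j → suc (hub C j) ≡ suc (tail (corner i)))
      fresh-covered 0F = inj₂ (inj₂ (map₂ (cong suc) ht))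
      fresh-covered 1F = inj₂ (inj₂ (map₂ (cong suc) (subst (Hub C) (sym (tail-φ x)) hh)))
      fresh-covered 2F = inj₁ refl

-- Construction of the hubs and their leaves

record Stage (n k s m : ℕ) : Set₁ where
  field
    K        : TriMap n
    C        : HubColouring K k s
    M        : MapMatching K m
    x        : TriMap.Dart K
    hub-face : HubFace K x C
    -- This corner of the current face is kept for the first path vertex.
    free     : Unmatched M (TriMap.hd K x)

-- A new hub h inside the face of x, a leaf inside each of the faces h now forms with the two other
-- edges of that face, and a matching edge from h to the first of these leaves.
module Step {n k s m : ℕ} (S : Stage n k s m) where
  open Stage S
  open TriMap K

  y z : Dart
  y = φ x
  z = φ (φ x)

  K₁ : TriMap (1 + n)
  K₁ = stack K x

  C₁ : HubColouring K₁ (3 + k) (1 + s)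
  C₁ = stack-hub K x C

  hub-face₁ : ∀ {w} → OnFace K x w → Hub C (tail w) → Hub C (hd w) → HubFace K₁ (old w) C₁
  hub-face₁ on (i , p) (j , q) = (suc i , cong suc p) , (suc j , cong suc q) , (zero , sym (third-corner K x on))

  hub-face-x : HubFace K₁ (old x) C₁
  hub-face-x = hub-face₁ (0F , refl) (proj₁ hub-face) (proj₁ (proj₂ hub-face))

  hub-face-y : HubFace K₁ (old y) C₁
  hub-face-y = hub-face₁ (1F , refl) (subst (Hub C) (sym (tail-φ x)) (proj₁ (proj₂ hub-face)))
    (subst (Hub C) (tail-φ y) (proj₂ (proj₂ hub-face)))

  hub-face-z : HubFace K₁ (old z) C₁
  hub-face-z = hub-face₁ (2F , refl) (proj₂ (proj₂ hub-face))
    (subst (Hub C) (trans (cong tail (sym (φ³ x))) (tail-φ z)) (proj₁ hub-face))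

  K₂ : TriMap (2 + n)
  K₂ = stack K₁ (old y)

  C₂ : HubColouring K₂ (6 + k) (1 + s)
  C₂ = stack-leaf K₁ (old y) C₁ hub-face-y

  z≢y : z ≢ y
  z≢y e = no-loop y (trans (sym (tail-φ y)) (cong tail e))

  x≢y : x ≢ y
  x≢y e = no-loop x (trans (sym (tail-φ x)) (cong tail (sym e)))

  x≢z : x ≢ z
  x≢z e = no-loop z (trans (sym (tail-φ z)) (cong tail (trans (φ³ x) e)))

  off-y : ∀ {w} → w ≢ y → ¬ OnFace K₁ (old y) (old w)
  off-y w≢y on = w≢y (OnFace-corner K x (1F , refl) on)

  K₃ : TriMap (3 + n)
  K₃ = stack K₂ (old (old z))

  keep : ∀ {n k s} (K : TriMap n) (x : TriMap.Dart K) (C : HubColouring K k s) (f : HubFace K x C) {w} →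
    ¬ OnFace K x w → HubFace K w C → HubFace (stack K x) (old w) (stack-leaf K x C f)
  keep K x C f ¬on (ht , hh , h3) = map₂ (cong suc) ht , map₂ (cong suc) hh ,
    map₂ (λ e → trans (cong suc e) (sym (third-off K x ¬on))) h3

  hub-face-z₂ : HubFace K₂ (old (old z)) C₂
  hub-face-z₂ = keep K₁ (old y) C₁ hub-face-y (off-y z≢y) hub-face-z

  C₃ : HubColouring K₃ (9 + k) (1 + s)
  C₃ = stack-leaf K₂ (old (old z)) C₂ hub-face-z₂

  off-z : ¬ OnFace K₂ (old (old z)) (old (old x))
  off-z on = x≢z (OnFace-corner K x (2F , refl) (OnFace-off K₁ (old y) (off-y z≢y) on))

  M₂′ : MapMatching K₂ m
  M₂′ = lift-matching K₁ (old y) (lift-matching K x M)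

  hub-end : TriMap.third K₁ (old y) ≡ zero
  hub-end = third-corner K x (1F , refl)

  M₂ : MapMatching K₂ (1 + m)
  -- `out 2F` runs from the leaf to the third corner of the face of `old y`, which is the new hub by
  -- `hub-end`.
  M₂ = add-edge K₂ M₂′ (out 2F) (unmatched-new K₁ (old y) (lift-matching K x M))
    (subst (Unmatched M₂′) (cong suc (sym hub-end)) (unmatched-lift K₁ (old y) (lift-matching K x M) (unmatched-new K x M)))

  M₃ : MapMatching K₃ (1 + m)
  M₃ = lift-matching K₂ (old (old z)) M₂

  unmatched₃ : ∀ {v} → Unmatched M v → Unmatched M₃ (suc (suc (suc v)))
  unmatched₃ {v} ¬v = unmatched-lift K₂ (old (old z)) M₂ (unmatched-add K₂ M₂′
    (unmatched-lift K₁ (old y) (lift-matching K x M) (unmatched-lift K x M ¬v)) (λ ())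
    λ e → contradiction (trans (suc-injective e) hub-end) λ ())

  step-stage : Stage (3 + n) (9 + k) (1 + s) (1 + m)
  step-stage = record { K = K₃ ; C = C₃ ; M = M₃ ; x = old (old (old x))
    ; hub-face = keep K₂ (old (old z)) C₂ hub-face-z₂ off-z (keep K₁ (old y) C₁ hub-face-y (off-y x≢y) hub-face-x)
    ; free = unmatched₃ free }

module Triangle where
  tail₀ : Fin 3 ⊎ Fin 3 → Fin 3
  tail₀ (inj₁ i) = i
  tail₀ (inj₂ i) = next i

  φ₀ : Fin 3 ⊎ Fin 3 → Fin 3 ⊎ Fin 3
  φ₀ (inj₁ i) = inj₁ (next i)
  φ₀ (inj₂ i) = inj₂ (prev i)

  next³ : ∀ i → next (next (next i)) ≡ i
  next³ 0F = refl
  next³ 1F = refl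
  next³ 2F = refl

  prev³ : ∀ i → prev (prev (prev i)) ≡ i
  prev³ 0F = refl
  prev³ 1F = refl
  prev³ 2F = refl

  next≢ : ∀ i → next i ≢ i
  next≢ 0F ()
  next≢ 1F ()
  next≢ 2F ()

  next-injective : ∀ {i j} → next i ≡ next j → i ≡ j
  next-injective {i} {j} e = trans (sym (prev-next i)) (trans (cong prev e) (prev-next j))

  next²≢ : ∀ i → next (next i) ≢ i
  next²≢ i e = next≢ i (trans (sym (cong next e)) (next³ i))

  φ₀³ : ∀ x → φ₀ (φ₀ (φ₀ x)) ≡ x
  φ₀³ (inj₁ i) = cong inj₁ (next³ i)
  φ₀³ (inj₂ i) = cong inj₂ (prev³ i)

  tail-φ₀ : ∀ x → tail₀ (φ₀ x) ≡ tail₀ (Sum.swap x)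
  tail-φ₀ (inj₁ i) = refl
  tail-φ₀ (inj₂ i) = next-prev i

  orbit₀ : ∀ x y → tail₀ x ≡ tail₀ y → ∃ λ k → iter (φ₀ ∘ Sum.swap) k x ≡ y
  orbit₀ (inj₁ i) (inj₁ j) e = 0 , cong inj₁ e
  orbit₀ (inj₁ i) (inj₂ j) e = 1 , cong inj₂ (trans (cong prev e) (prev-next j))
  orbit₀ (inj₂ i) (inj₁ j) e = 1 , cong inj₁ e
  orbit₀ (inj₂ i) (inj₂ j) e = 0 , cong inj₂ (next-injective e)

  no-loop₀ : ∀ x → tail₀ (Sum.swap x) ≢ tail₀ x
  no-loop₀ (inj₁ i) e = next≢ i e
  no-loop₀ (inj₂ i) e = next≢ i (sym e)

  no-multi₀ : ∀ x y → tail₀ x ≡ tail₀ y → tail₀ (Sum.swap x) ≡ tail₀ (Sum.swap y) → x ≡ y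
  no-multi₀ (inj₁ i) (inj₁ j) t h = cong inj₁ t
  no-multi₀ (inj₁ i) (inj₂ j) t h = contradiction (trans (sym (cong next t)) h) (next²≢ j)
  no-multi₀ (inj₂ i) (inj₁ j) t h = contradiction (trans (cong next t) (sym h)) (next²≢ i)
  no-multi₀ (inj₂ i) (inj₂ j) t h = cong inj₂ h

  Adjacent₀ : Fin 3 → Fin 3 → Set
  Adjacent₀ a b = ∃ λ x → tail₀ x ≡ a × tail₀ (Sum.swap x) ≡ b

  reach₀ : ∀ i j → j ≡ i ⊎ j ≡ next i ⊎ j ≡ next (next i) → Reach Adjacent₀ i j
  reach₀ i _ (inj₁ refl)        = here
  reach₀ i _ (inj₂ (inj₁ refl)) = step (inj₁ i , refl , refl) here
  reach₀ i _ (inj₂ (inj₂ refl)) = step (inj₁ i , refl , refl) (step (inj₁ (next i) , refl , refl) here)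

  rotations : ∀ i j → j ≡ i ⊎ j ≡ next i ⊎ j ≡ next (next i)
  rotations 0F 0F = inj₁ refl
  rotations 0F 1F = inj₂ (inj₁ refl)
  rotations 0F 2F = inj₂ (inj₂ refl)
  rotations 1F 0F = inj₂ (inj₂ refl)
  rotations 1F 1F = inj₁ refl
  rotations 1F 2F = inj₂ (inj₁ refl)
  rotations 2F 0F = inj₂ (inj₁ refl)
  rotations 2F 1F = inj₂ (inj₂ refl)
  rotations 2F 2F = inj₁ refl

  swap-invol : ∀ (x : Fin 3 ⊎ Fin 3) → Sum.swap (Sum.swap x) ≡ x
  swap-invol (inj₁ _) = refl
  swap-invol (inj₂ _) = refl

  triangle : TriMap 3
  triangle = record
    { Dart = Fin 3 ⊎ Fin 3 ; enum = ↔-sym +↔⊎ ; tail = tail₀ ; α = Sum.swap ; φ = φ₀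
    ; α-invol = swap-invol ; φ³ = φ₀³ ; tail-φ = tail-φ₀ ; orbit = orbit₀ ; no-loop = no-loop₀ ; no-multi = no-multi₀
    ; connected = λ i j → reach₀ i j (rotations i j) ; euler = 3 , 2 , refl , refl , refl }

  colouring : HubColouring triangle 3 3
  colouring = record
    { colour = λ x → suc (toℕ ([ id , id ]′ x))
    ; colour-α = λ { (inj₁ _) → refl ; (inj₂ _) → refl }
    ; colour≤ = λ x → toℕ<n ([ id , id ]′ x)
    ; colour-onto = λ { (s≤s {n = c} z≤n) c<3 → inj₁ (fromℕ< c<3) , cong suc (toℕ-fromℕ< c<3) }
    ; hub = id
    ; covered = λ x → inj₂ (inj₁ (tail₀ x , refl)) }

  no-edges : MapMatching triangle 0
  no-edges = record { edge = λ () ; disjoint = λ () }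

  K₄ : TriMap 4
  K₄ = stack triangle (inj₂ 0F)

  leaf-edge : MapMatching K₄ 1
  -- Corner `1F` of this face is the hub `0F`, so `hd x` in `stage₄`, which comes from the hub `1F`,
  -- stays unmatched.
  leaf-edge = add-edge K₄ (lift-matching triangle (inj₂ 0F) no-edges) (out 1F) (λ ()) (λ ())

  stage₄ : Stage 4 6 3 1
  stage₄ = record
    { K = K₄
    ; C = stack-leaf triangle (inj₂ 0F) colouring ((1F , refl) , (0F , refl) , (2F , refl))
    ; M = leaf-edge
    ; x = old (inj₁ 0F)
    ; hub-face = (0F , refl) , (1F , refl) , (2F , refl)
    ; free = λ { 0F (inj₁ ()) ; 0F (inj₂ ()) } }

  open Step stage₄

  -- The second leaf of the first step is matched as well: from here on, all hubs but hd x are matched.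
  stage₇ : Stage 7 15 4 3
  stage₇ = record
    { Stage step-stage
    ; M = add-edge K₃ M₃ (out 0F) (unmatched-new K₂ (old (old z)) M₂) (unmatched₃ λ { 0F (inj₁ ()) ; 0F (inj₂ ()) })
    ; free = unmatched-add K₃ M₃ (Stage.free step-stage) (λ ()) (λ ()) }

stages : ∀ j → Stage (j * 3 + 7) (j * 9 + 15) (j + 4) (j + 3)
stages zero    = Triangle.stage₇
stages (suc j) = Step.step-stage (stages j)

-- The path inside the remaining face

record Fan (n k s m : ℕ) : Set₁ where
  field
    K        : TriMap n
    C        : HubColouring K k s
    M        : MapMatching K m
    x        : TriMap.Dart K
    hub-tail : Hub C (TriMap.tail K x)
    hub-hd   : Hub C (TriMap.hd K x)

module _ {n k s m : ℕ} where

  -- The first path vertex sees three hubs, so its edges all get new colours. It is matched to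
  -- `hd x`, the corner that was kept free.
  start-fan : Stage n k s m → Fan (1 + n) (3 + k) s (1 + m)
  start-fan S = record { K = stack K x ; C = stack-leaf K x C hub-face ; x = old x
    ; M = add-edge (stack K x) (lift-matching K x M) (out 1F) (unmatched-new K x M)
            (unmatched-lift K x M (subst (Unmatched M) (sym (TriMap.tail-φ K x)) free))
    ; hub-tail = map₂ (cong suc) (proj₁ hub-face) ; hub-hd = map₂ (cong suc) (proj₁ (proj₂ hub-face)) }
    where open Stage S

  fan-step : Fan n k s m → Fan (1 + n) (2 + k) s m
  fan-step S = record { K = stack K x ; C = stack-shared K x C hub-tail hub-hd ; x = old x ; M = lift-matching K x M
    ; hub-tail = map₂ (cong suc) hub-tail ; hub-hd = map₂ (cong suc) hub-hd }
    where open Fan S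

  fan-step-third : (S : Fan n k s m) → TriMap.third (Fan.K (fan-step S)) (Fan.x (fan-step S)) ≡ zero
  fan-step-third S = third-corner (Fan.K S) (Fan.x S) (0F , refl)

  fan-step-unmatched : (S : Fan n k s m) → Unmatched (Fan.M (fan-step S)) zero
  fan-step-unmatched S = unmatched-new (Fan.K S) (Fan.x S) (Fan.M S)

SharedUsed : ∀ {n k s m} → Fan n k s m → Set
SharedUsed S = ∃ λ w → colour (Fan.C S) w ≡ 0

-- The two new path vertices are matched to each other by an edge of the shared colour; the third
-- corner of the face is the first of them.
fan-pair : ∀ {n k s m} → Fan n k s m → Fan (2 + n) (4 + k) s (1 + m)
fan-pair S = record { Fan S₂ ; M = add-edge K₂ (Fan.M S₂) (out 2F) (fan-step-unmatched S₁)
    (unmatched-lift (Fan.K S₁) (Fan.x S₁) (Fan.M S₁)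
      (subst (Unmatched (Fan.M S₁)) (sym (fan-step-third S)) (fan-step-unmatched S))) }
  where
  S₁ = fan-step S
  S₂ = fan-step S₁
  K₂ = Fan.K S₂

fan-steps : ∀ {n k s m} r → Fan n k s m → Fan (r + n) (r * 2 + k) s m
fan-steps zero    S = S
fan-steps (suc r) S = fan-step (fan-steps r S)

fan-steps-shared : ∀ {n k s m} r {S : Fan n k s m} → SharedUsed S → SharedUsed (fan-steps r S)
fan-steps-shared zero    u = u
fan-steps-shared (suc r) u = out 2F , refl

-- Transfer to `PlaneTriangulation` and exclusion of rainbow matchings

module Realise {n : ℕ} (K : TriMap n) where
  open TriMap K using (Dart; size; enum; hd) renaming (tail to tailᴷ; α to αᴷ; φ to φᴷ)

  from : Fin size → Dart
  from = Inverse.from enum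

  to : Dart → Fin size
  to = Inverse.to enum

  from-to : ∀ w → from (to w) ≡ w
  from-to = Inverse.strictlyInverseʳ enum

  to-from : ∀ x → to (from x) ≡ x
  to-from = Inverse.strictlyInverseˡ enum

  from-injective : ∀ {x y} → from x ≡ from y → x ≡ y
  from-injective {x} {y} e = trans (sym (to-from x)) (trans (cong to e) (to-from y))

  conj : (Dart → Dart) → Fin size → Fin size
  conj f x = to (f (from x))

  from-conj : ∀ f x → from (conj f x) ≡ f (from x)
  from-conj f x = from-to (f (from x))

  iter-conj : ∀ f k x → from (iter (conj f) k x) ≡ iter f k (from x)
  iter-conj f zero    x = refl
  iter-conj f (suc k) x = trans (from-conj f _) (cong f (iter-conj f k x))

  tail : Fin size → Fin n
  tail x = tailᴷ (from x)

  α σ σ⁻¹ : Fin size → Fin size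
  α   = conj αᴷ
  σ   = conj (φᴷ ∘ αᴷ)
  -- `φᴷ` has order three and `αᴷ` order two, so this inverts `φᴷ ∘ αᴷ`.
  σ⁻¹ = conj (αᴷ ∘ φᴷ ∘ φᴷ)

  tail-α : ∀ x → tail (α x) ≡ hd (from x)
  tail-α x = cong tailᴷ (from-conj αᴷ x)

  from-σα : ∀ x → from (σ (α x)) ≡ φᴷ (from x)
  from-σα x = trans (from-conj (φᴷ ∘ αᴷ) (α x)) (cong φᴷ (trans (cong αᴷ (from-conj αᴷ x)) (TriMap.α-invol K (from x))))

  reach : ∀ {u v} → Reach (TriMap.Adjacent K) u v → Reach (λ a b → ∃ λ x → tail x ≡ a × tail (α x) ≡ b) u v
  reach here = here
  reach (step (w , t , h) r) =
    step (to w , trans (cong tailᴷ (from-to w)) t , trans (tail-α (to w)) (trans (cong hd (from-to w)) h)) (reach r)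

  triangulation : PlaneTriangulation n
  triangulation = record
    { d = size ; tail = tail ; α = α ; σ = σ ; σ⁻¹ = σ⁻¹
    ; α-invol = λ x → from-injective (trans (from-conj αᴷ (α x)) (trans (cong αᴷ (from-conj αᴷ x)) (TriMap.α-invol K (from x))))
    ; α-nofix = λ x e → TriMap.no-loop K (from x) (trans (sym (tail-α x)) (cong tail e))
    ; σ-inv₁ = λ x → from-injective (trans (from-conj (φᴷ ∘ αᴷ) (σ⁻¹ x)) (trans (cong (φᴷ ∘ αᴷ) (from-conj (αᴷ ∘ φᴷ ∘ φᴷ) x))
        (trans (cong φᴷ (TriMap.α-invol K _)) (TriMap.φ³ K (from x)))))
    ; σ-inv₂ = λ x → from-injective (trans (from-conj (αᴷ ∘ φᴷ ∘ φᴷ) (σ x)) (trans (cong (αᴷ ∘ φᴷ ∘ φᴷ) (from-conj (φᴷ ∘ αᴷ) x))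
        (trans (cong αᴷ (TriMap.φ³ K _)) (TriMap.α-invol K (from x)))))
    ; σ-vertex = λ x → trans (cong tailᴷ (from-conj (φᴷ ∘ αᴷ) x)) (trans (TriMap.tail-φ K _) (cong tailᴷ (TriMap.α-invol K (from x))))
    ; σ-transitive = λ x y e → map₂ (λ {k} p → from-injective (trans (iter-conj (φᴷ ∘ αᴷ) k x) p)) (TriMap.orbit K (from x) (from y) e)
    ; no-loop = λ x e → TriMap.no-loop K (from x) (trans (sym (tail-α x)) e)
    ; no-multi = λ x y t h → from-injective (TriMap.no-multi K (from x) (from y) t (trans (sym (tail-α x)) (trans h (tail-α y))))
    ; face-tri = λ x → from-injective (trans (from-σα _) (trans (cong φᴷ (trans (from-σα _) (cong φᴷ (from-σα x)))) (TriMap.φ³ K (from x))))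
    ; face-nontriv = λ x e → TriMap.no-loop K (from x)
        (trans (sym (TriMap.tail-φ K (from x))) (cong tailᴷ (trans (sym (from-σα x)) (cong from e))))
    ; connected = λ u v → reach (TriMap.connected K u v)
    ; euler = TriMap.euler K }

  matching : ∀ {m} → MapMatching K m → Matching triangulation m
  matching M = record { e = to ∘ edge M ; disjoint = λ i j i≢j →
    (λ e → i≢j (disjoint M i j (inj₁ refl) (inj₁ (trans (sym (at-tail i)) (trans e (at-tail j)))))) ,
    (λ e → i≢j (disjoint M i j (inj₁ refl) (inj₂ (trans (sym (at-tail i)) (trans e (at-head j)))))) ,
    (λ e → i≢j (disjoint M i j (inj₂ refl) (inj₁ (trans (sym (at-head i)) (trans e (at-tail j)))))) ,
    (λ e → i≢j (disjoint M i j (inj₂ refl) (inj₂ (trans (sym (at-head i)) (trans e (at-head j)))))) }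
    where
    at-tail : ∀ i → tail (to (edge M i)) ≡ tailᴷ (edge M i)
    at-tail i = cong tailᴷ (from-to (edge M i))

    at-head : ∀ i → tail (α (to (edge M i))) ≡ hd (edge M i)
    at-head i = trans (tail-α (to (edge M i))) (cong hd (from-to (edge M i)))

  module _ {k s : ℕ} (C : HubColouring K k s) (shared-used : ∃ λ w → colour C w ≡ 0) where

    edge-colouring : EdgeColoring triangulation (suc k)
    edge-colouring = record
      { col = λ x → fromℕ< (s≤s (colour≤ C (from x)))
      ; col-edge = λ x → fromℕ<-cong _ _ (trans (cong (colour C) (from-conj αᴷ x)) (colour-α C (from x))) _ _
      ; col-surj = λ c → let w , e = attained c in to w ,
          toℕ-injective (trans (toℕ-fromℕ< _) (trans (cong (colour C) (from-to w)) e)) }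
      where
      attained : ∀ (c : Fin (suc k)) → ∃ λ w → colour C w ≡ toℕ c
      attained zero    = shared-used
      attained (suc c) = colour-onto C (s≤s z≤n) (toℕ<n c)

    Covering : Dart → Set
    Covering w = colour C w ≡ 0 ⊎ Hub C (tailᴷ w) ⊎ Hub C (hd w)

    -- The pigeonholes: one for the shared colour and one for each hub.
    class-of : ∀ {w} → Covering w → Fin (suc s)
    class-of (inj₁ _)              = zero
    class-of (inj₂ (inj₁ (j , _))) = suc j
    class-of (inj₂ (inj₂ (j , _))) = suc j

    hub-class : ∀ {w} (p : Covering w) {j} → class-of p ≡ suc j → OnDart K (hub C j) w
    hub-class (inj₂ (inj₁ (j , e))) refl = inj₁ e
    hub-class (inj₂ (inj₂ (j , e))) refl = inj₂ e

    shared-class : ∀ {w} (p : Covering w) → class-of p ≡ zero → colour C w ≡ 0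
    shared-class (inj₁ e) _ = e
    shared-class (inj₂ (inj₁ _)) ()
    shared-class (inj₂ (inj₂ _)) ()

    -- Two edges of a rainbow matching can neither both have the shared colour nor meet a common hub.
    no-rainbow : ∀ {t} → suc s < t → ¬ HasRainbowMatching triangulation edge-colouring t
    no-rainbow {t} s+1<t (N , rainbow) with i , j , i<j , e ← pigeonhole s+1<t (λ i → class-of (covered C (from (Matching.e N i))))
      with class-of (covered C (from (Matching.e N i))) in eᵢ
    ... | zero  = rainbow i j i≢j (fromℕ<-cong _ _
        (trans (shared-class (covered C (from (Matching.e N i))) eᵢ) (sym (shared-class (covered C (from (Matching.e N j))) (sym e)))) _ _)
      where
      i≢j : i ≢ j
      i≢j refl = <-irrefl refl i<j
    ... | suc l = meet (hub-class (covered C (from (Matching.e N i))) eᵢ) (hub-class (covered C (from (Matching.e N j))) (sym e))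
        (Matching.disjoint N i j λ { refl → <-irrefl refl i<j })
      where
      meet : ∀ {u x y} → OnDart K u (from x) → OnDart K u (from y) →
        ¬ ((tail x ≢ tail y) × (tail x ≢ tail (α y)) × (tail (α x) ≢ tail y) × (tail (α x) ≢ tail (α y)))
      meet         (inj₁ p) (inj₁ q) (tt≢ , _)         = tt≢ (trans (sym p) q)
      meet {y = y} (inj₁ p) (inj₂ q) (_ , th≢ , _)     = th≢ (trans (sym p) (trans q (sym (tail-α y))))
      meet {x = x} (inj₂ p) (inj₁ q) (_ , _ , ht≢ , _) = ht≢ (trans (tail-α x) (trans (sym p) q))
      meet {x = x} {y} (inj₂ p) (inj₂ q) (_ , _ , _ , hh≢) = hh≢ (trans (tail-α x) (trans (sym p) (trans q (sym (tail-α y)))))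

-- Assembly of the two bounds

lower-bound : ∀ j r {t n} → 6 + j ≡ t → r + (5 + (j * 3 + 7)) ≡ n →
  Σ (PlaneTriangulation n) λ T → Σ ℕ λ k → Σ (EdgeColoring T k) λ c →
    ContainsMatching T t × ¬ HasRainbowMatching T c t × (2 * n + 3 * t ∸ 15 ≤ k)
lower-bound j r refl refl =
  triangulation , suc (r * 2 + (11 + (j * 9 + 15))) , edge-colouring (Fan.C S) used ,
  subst (Matching triangulation) (cong (3 +_) (+-comm j 3)) (matching (Fan.M S)) ,
  no-rainbow (Fan.C S) used (≤-reflexive (cong (2 +_) (+-comm j 4))) ,
  m≤n+o⇒m∸n≤o _ 15 (≤-reflexive colours)
  where
  S : Fan (r + (5 + (j * 3 + 7))) (r * 2 + (11 + (j * 9 + 15))) (j + 4) (3 + (j + 3))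
  -- With `t = 6 + j` there are t - 2 hubs, all matched once the fan is started; two pairs raise the
  -- matching to t edges on 3t - 6 vertices. The other `r` vertices lengthen the path.
  S = fan-steps r (fan-pair (fan-pair (start-fan (stages j))))

  used : SharedUsed S
  used = fan-steps-shared r (out 2F , refl)

  open Realise (Fan.K S)

  colours : 2 * (r + (5 + (j * 3 + 7))) + 3 * (6 + j) ≡ 15 + suc (r * 2 + (11 + (j * 9 + 15)))
  colours = solve (j ∷ r ∷ [])

theorem3 : ∀ (t n : ℕ) → 6 ≤ t → 3 * t ∸ 6 ≤ n →
    (Σ (PlaneTriangulation n) λ T → Σ ℕ λ k → Σ (EdgeColoring T k) λ c →
    ContainsMatching T t × ¬ HasRainbowMatching T c t × (2 * n + 3 * t ∸ 15 ≤ k))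
    × (∀ (T : PlaneTriangulation n) (k : ℕ) (c : EdgeColoring T k) →
    ContainsMatching T t → ¬ HasRainbowMatching T c t → k ≤ 2 * n + 4 * t ∸ 14)
theorem3 t n 6≤t 3t∸6≤n =
  (let j , 6+j≡t = m≤n⇒∃[o]m+o≡n 6≤t
       r , 3t+r≡6+n = m≤n⇒∃[o]m+o≡n 3t≤6+n
   in lower-bound j r 6+j≡t (+-cancelˡ-≡ 6 _ _ (trans (vertices j r) (trans (cong (λ t → 3 * t + r) 6+j≡t) 3t+r≡6+n)))) ,
  λ T k c _ → RainbowFree.upper-bound T c t 6≤t (subst (3 * t ≤_) (+-comm 6 n) 3t≤6+n)
  where
  3t≤6+n : 3 * t ≤ 6 + n
  3t≤6+n = ≤-trans (m≤n+m∸n (3 * t) 6) (+-monoʳ-≤ 6 3t∸6≤n)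

  vertices : ∀ j r → 6 + (r + (5 + (j * 3 + 7))) ≡ 3 * (6 + j) + r
  vertices j r = solve (j ∷ r ∷ [])
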